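{- Each of the following sums is universal over $\mathbb{Z}$: $2p_5+2p_5+p_8+p_8$, $p_8+p_8+p_8+p_8$, $3p_4+3p_4+p_8+p_8$, $6p_3+3p_4+2p_5+p_8$, $3p_3+p_5+2p_5+2p_5$, $3p_3+p_5+p_8+p_8$, $3p_4+p_5+p_5+p_8$, $6p_3+p_5+p_5+2p_5$, $p_5+p_5+p_5+4p_5$, $p_5+p_5+p_5+2p_8$, $p_3+p_3+2p_4+3p_5$, $p_3+p_3+4p_3+3p_5$, $p_4+2p_5+3p_5+4p_5$, $p_4+2p_5+3p_5+2p_8$, $2p_5+2p_5+2p_5+p_8$, $2p_5+p_8+p_8+p_8$.
   Context: For an integer $m\ge 3$ and $x\in\mathbb{Z}$, the generalized $m$-gonal number is $p_m(x)=\frac{(m-2)x^2-(m-4)x}{2}$; thus $p_3(x)=x(x+1)/2$, $p_4(x)=x^2$, $p_5(x)=x(3x-1)/2$, $p_8(x)=x(3x-2)$. For positive integers $a,b,c,d$ and $r,s,t,u\in\{3,4,5,8\}$, the notation $ap_r+bp_s+cp_t+dp_u$ denotes the function $(h,l,m,n)\mapsto ap_r(h)+bp_s(l)+cp_t(m)+dp_u(n)$ on $\mathbb{Z}^4$ (four independent integer variables). Such a sum is called universal over $\mathbb{Z}$ if its set of values on $\mathbb{Z}^4$ equals $\mathbb{N}_0=\{0,1,2,\dots\}$. -}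

module Defs where

open import Data.Nat using (ℕ)
open import Data.Integer using (ℤ; +_; _+_; _-_; _*_)
open import Data.Integer.DivMod using (_/ℕ_)
open import Data.Product using (∃; Σ; _×_; _,_)
open import Relation.Binary.PropositionalEquality using (_≡_)

-- Generalized m-gonal number p_m(x) = ((m-2)x^2 - (m-4)x)/2, for m ≥ 3.
-- The numerator is always even, so the (floor) division by 2 is exact.
gonal : ℕ → ℤ → ℤ
gonal m x = ((+ m - + 2) * x * x - (+ m - + 4) * x) /ℕ 2

quaternary : ℕ → ℕ → ℕ → ℕ → ℕ → ℕ → ℕ → ℕ → ℤ → ℤ → ℤ → ℤ → ℤ
quaternary a r b s c t d u h l m n =
  + a * gonal r h + + b * gonal s l + + c * gonal t m + + d * gonal u n

Universal : ℕ → ℕ → ℕ → ℕ → ℕ → ℕ → ℕ → ℕ → Set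
Universal a r b s c t d u =
  (∀ h l m n → Σ ℕ (λ k → quaternary a r b s c t d u h l m n ≡ + k))
  × (∀ (k : ℕ) → ∃ λ h → ∃ λ l → ∃ λ m → ∃ λ n →
       quaternary a r b s c t d u h l m n ≡ + k)

{-# OPTIONS --safe #-}

-- Completing squares turns each sum into a representation of 3n + r, 8n + r, 12n + r or 24n + r by
-- four squares with prescribed residues mod 2, 3 and 4, after x² + y² has been traded for
-- ((x + y)² + (x - y)²) / 2 and x² + 2y² for ((x + 2y)² + 2(x - y)²) / 3 where needed.
-- The value of the sum mod 4 or 8 forces the parities, so only the residues mod 3 are at stake.
-- Lagrange's theorem gives some representation.  Three coordinates divisible by 3 and not all 0 can be
-- replaced by three coordinates prime to 3: the reflection of (a, b, c) in the plane orthogonal to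
-- (1, 1, 1) has denominator 3, and 3 times it is prime to 3 as soon as 3 ∤ a + b + c.
-- The only obstruction is m = x² + 0² + 0² + 0²; it is avoided since every m ≥ 2 has another
-- representation, which for m = k² with k odd comes from squaring a quaternion of norm k.
module Submission where

open import Defs
open import Data.Bool using (Bool; true; false; not)
open import Data.Fin using (Fin; toℕ; fromℕ<; splitAt; join)
open import Data.Fin.Properties using (pigeonhole; toℕ-fromℕ<; toℕ<n; toℕ-injective; join-splitAt)
open import Data.Integer using (ℤ; +_; -[1+_]; _+_; _-_; _*_; -_; ∣_∣; 0ℤ; 1ℤ)
import Data.Integer.DivMod as ℤ
import Data.Integer.Properties as ℤ
open import Data.Integer.Tactic.RingSolver using (solve; solve-∀)
open import Data.List using ([]; _∷_)
open import Data.Nat as ℕ using (ℕ; zero; suc)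
open import Data.Nat.Divisibility using (_∣_; divides; ∣⇒≤; quotient; quotient-<)
import Data.Nat.DivMod as ℕ
open import Data.Nat.Induction using (<-rec)
open import Data.Nat.Primality
import Data.Nat.Properties as ℕ
import Data.Nat.Tactic.RingSolver as ℕ
open import Data.Product using (∃; ∃₂; _×_; _,_; proj₂)
open import Data.Sum using (_⊎_; inj₁; inj₂; [_,_]′)
open import Data.Unit using (tt)
open import Level using (0ℓ)
open import Relation.Binary.Definitions using (tri<; tri≈; tri>)
open import Relation.Binary.PropositionalEquality
open import Relation.Nullary using (¬_; contradiction; yes; no)
open import Relation.Unary using (Pred; U; _∩_; _⊆_)

-- Rotation does not control parities, so the residues modulo 3 are arranged first and the parities
-- are read off afterwards. A square is 0 or 1 modulo 3, so the value modulo 3 gives the number of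
-- coordinates prime to 3, modulo 3. A rotation acts on three coordinates at once, hence the bound
-- aimed at is that at least two of the four are prime to 3: with fewer, three are divisible by 3
-- and can be rotated. Among the counts 2, 3, 4 the value modulo 3 then picks one: twelve of the
-- sums lead to values that are 1 modulo 3 (count 4) or 2 modulo 3 (count 2). The four sums
-- containing 3p₅ are harder. They lead to 8n + 3 and 8n + 7, whose residue modulo 3 varies with n,
-- so all three counts occur. There one odd coordinate prime to 3 serves the term 3p₅, and a weak
-- condition on the other three is kept, just enough for the trade of x² + 2y² to give two squares
-- prime to 3.

private variable
  P Q S T P′ Q′ S′ T′ : Pred ℤ 0ℓ
  m : ℤ

-- The ring solver proves unconditional identities only. A hypothesis `a ≡ b` enters through the
-- cofactor `c`, and what remains for the solver is `x - y ≡ c * (a - b)`.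
from-difference : ∀ {x y a b} c → a ≡ b → x - y ≡ c * (a - b) → x ≡ y
from-difference {a = a} c refl e =
  ℤ.i-j≡0⇒i≡j _ _ (trans e (trans (cong (c *_) (ℤ.+-inverseʳ a)) (ℤ.*-zeroʳ c)))

-- Sums of four squares with a condition on each coordinate

data Sum4 (P Q S T : Pred ℤ 0ℓ) (m : ℤ) : Set where
  sum4 : ∀ {a b c d} → P a → Q b → S c → T d →
         m ≡ a * a + b * b + c * c + d * d → Sum4 P Q S T m

FourSquares : ℤ → Set
FourSquares = Sum4 U U U U

fourSquares : ∀ a b c d → m ≡ a * a + b * b + c * c + d * d → FourSquares m
fourSquares a b c d = sum4 {a = a} {b} {c} {d} tt tt tt tt

swap₁₂ : Sum4 P Q S T m → Sum4 Q P S T m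
swap₁₂ (sum4 {a} {b} {c} {d} p q s t refl) = sum4 q p s t (solve (a ∷ b ∷ c ∷ d ∷ []))

swap₂₃ : Sum4 P Q S T m → Sum4 P S Q T m
swap₂₃ (sum4 {a} {b} {c} {d} p q s t refl) = sum4 p s q t (solve (a ∷ b ∷ c ∷ d ∷ []))

swap₃₄ : Sum4 P Q S T m → Sum4 P Q T S m
swap₃₄ (sum4 {a} {b} {c} {d} p q s t refl) = sum4 p q t s (solve (a ∷ b ∷ c ∷ d ∷ []))

_⊑_ : Pred ℤ 0ℓ → Pred ℤ 0ℓ → Set
P ⊑ Q = ∀ x → P x → ∃ λ y → Q y × y * y ≡ x * x

map4 : P ⊑ P′ → Q ⊑ Q′ → S ⊑ S′ → T ⊑ T′ → Sum4 P Q S T m → Sum4 P′ Q′ S′ T′ m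
map4 f g h k (sum4 p q s t eq)
  with _ , p′ , e₁ ← f _ p | _ , q′ , e₂ ← g _ q | _ , s′ , e₃ ← h _ s | _ , t′ , e₄ ← k _ t =
  sum4 p′ q′ s′ t′
    (trans eq (sym (cong₂ _+_ (cong₂ _+_ (cong₂ _+_ e₁ e₂) e₃) e₄)))

Classified₄ : (P Q S T : Bool → Pred ℤ 0ℓ) → ℤ → Set
Classified₄ P Q S T m = ∃₂ λ i j → ∃₂ λ k l → Sum4 (P i) (Q j) (S k) (T l) m

-- Only the square of a coordinate matters, so `y` may differ from `x` in sign; modulo 3 this leaves
-- just two classes.
Classifies : (Bool → Pred ℤ 0ℓ) → Pred ℤ 0ℓ → Set
Classifies C P = ∀ x → P x → ∃ λ b → ∃ λ y → C b y × y * y ≡ x * x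

classify₄ : ∀ {C D E F} → Classifies C P → Classifies D Q → Classifies E S → Classifies F T →
            Sum4 P Q S T m → Classified₄ C D E F m
classify₄ f g h k (sum4 p q s t eq)
  with _ , _ , p′ , e₁ ← f _ p | _ , _ , q′ , e₂ ← g _ q
     | _ , _ , s′ , e₃ ← h _ s | _ , _ , t′ , e₄ ← k _ t =
  _ , _ , _ , _ , sum4 p′ q′ s′ t′
    (trans eq (sym (cong₂ _+_ (cong₂ _+_ (cong₂ _+_ e₁ e₂) e₃) e₄)))

data Sorted₄ (C : Bool → Pred ℤ 0ℓ) (m : ℤ) : Set where
  four  : Sum4 (C true)  (C true)  (C true)  (C true)  m → Sorted₄ C m
  three : Sum4 (C true)  (C true)  (C true)  (C false) m → Sorted₄ C m
  two   : Sum4 (C true)  (C true)  (C false) (C false) m → Sorted₄ C m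
  one   : Sum4 (C true)  (C false) (C false) (C false) m → Sorted₄ C m
  none  : Sum4 (C false) (C false) (C false) (C false) m → Sorted₄ C m

sort₄ : ∀ {C} → Classified₄ C C C C m → Sorted₄ C m
sort₄ (true  , true  , true  , true  , r) = four r
sort₄ (true  , true  , true  , false , r) = three r
sort₄ (true  , true  , false , true  , r) = three (swap₃₄ r)
sort₄ (true  , false , true  , true  , r) = three (swap₃₄ (swap₂₃ r))
sort₄ (false , true  , true  , true  , r) = three (swap₃₄ (swap₂₃ (swap₁₂ r)))
sort₄ (true  , true  , false , false , r) = two r
sort₄ (true  , false , true  , false , r) = two (swap₂₃ r)
sort₄ (true  , false , false , true  , r) = two (swap₂₃ (swap₃₄ r))
sort₄ (false , true  , true  , false , r) = two (swap₂₃ (swap₁₂ r))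
sort₄ (false , true  , false , true  , r) = two (swap₂₃ (swap₃₄ (swap₁₂ r)))
sort₄ (false , false , true  , true  , r) = two (swap₂₃ (swap₃₄ (swap₁₂ (swap₂₃ r))))
sort₄ (true  , false , false , false , r) = one r
sort₄ (false , true  , false , false , r) = one (swap₁₂ r)
sort₄ (false , false , true  , false , r) = one (swap₁₂ (swap₂₃ r))
sort₄ (false , false , false , true  , r) = one (swap₁₂ (swap₂₃ (swap₃₄ r)))
sort₄ (false , false , false , false , r) = none r

-- Residues modulo 2, 3 and 4

bit : Bool → ℕ
bit false = 0
bit true  = 1

-- The residues 0 and 1 suffice: they are all residues modulo 2, and all residues modulo 3 up to
-- sign.
Res : ℕ → Bool → Pred ℤ 0ℓ
Res c b x = ∃ λ k → x ≡ + c * k + + bit b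

Odd Even One₃ Zero₃ : Pred ℤ 0ℓ
Odd   = Res 2 true
Even  = Res 2 false
One₃  = Res 3 true
Zero₃ = Res 3 false

-- `A` and `B` are integers but `r` and `s` are naturals: the sign of `A - B` tells which of `r`,
-- `s` is the other plus a natural multiple of `c`. For numerals the conclusion computes, so
-- impossible residues are refuted by `()`.
remainder-unique : ∀ c .{{_ : ℕ.NonZero c}} A B r s →
                   + c * A + + r ≡ + c * B + + s → r ℕ.% c ≡ s ℕ.% c
remainder-unique c A B r s eq with A - B in D | difference A B (+ r) (+ s) (+ c) eq
  where
  difference : ∀ A B r s c → c * A + r ≡ c * B + s → s ≡ r + c * (A - B)
  difference A B r s c e = from-difference (- 1ℤ) e (solve (A ∷ B ∷ r ∷ s ∷ c ∷ []))
... | + k      | e = sym (go e)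
  where
  go : ∀ {r s} → + s ≡ + r + + c * + k → s ℕ.% c ≡ r ℕ.% c
  go {r} e = trans (cong (ℕ._% c) (ℤ.+-injective (trans e (cong (λ z → + r + z)
    (trans (ℤ.*-comm (+ c) (+ k)) (sym (ℤ.pos-* k c))))))) (ℕ.[m+kn]%n≡m%n r k c)
... | -[1+ k ] | e = go e
  where
  negate : ∀ r s c K → s ≡ r + c * - K → r ≡ s + K * c
  negate r s c K e = from-difference (- 1ℤ) e (solve (r ∷ s ∷ c ∷ K ∷ []))
  go : + s ≡ + r + + c * -[1+ k ] → r ℕ.% c ≡ s ℕ.% c
  go e = trans (cong (ℕ._% c) (ℤ.+-injective (trans (negate (+ r) (+ s) (+ c) (+ suc k) e)
    (cong (λ z → + s + z) (sym (ℤ.pos-* (suc k) c)))))) (ℕ.[m+kn]%n≡m%n s (suc k) c)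

SqRes : ℕ → Bool → Pred ℤ 0ℓ
SqRes c b x = ∃ λ t → x * x ≡ + c * t + + bit b

bit² : ∀ b → + bit b * + bit b ≡ + bit b
bit² false = refl
bit² true  = refl

Res⇒SqRes : ∀ c {b} → Res c b ⊆ SqRes c b
Res⇒SqRes c {b} (k , refl) = + c * k * k + + 2 * k * + bit b , from-difference 1ℤ (bit² b) (identity (+ c) (+ bit b) k)
  where
  identity : ∀ c β k → (c * k + β) * (c * k + β) - (c * (c * k * k + + 2 * k * β) + β) ≡ 1ℤ * (β * β - β)
  identity = solve-∀

Res₂⇒SqRes₄ : ∀ {b} → Res 2 b ⊆ SqRes 4 b
Res₂⇒SqRes₄ {b} (k , refl) = k * k + k * + bit b , from-difference 1ℤ (bit² b) (identity (+ bit b) k)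
  where
  identity : ∀ β k → (+ 2 * k + β) * (+ 2 * k + β) - (+ 4 * (k * k + k * β) + β) ≡ 1ℤ * (β * β - β)
  identity = solve-∀

-- Each coordinate of class `true` contributes 1 modulo `c` and each of class `false` contributes 0,
-- so `r` counts the `true` ones modulo `c`.
residue₄ : ∀ c .{{_ : ℕ.NonZero c}} {i j k l} M r →
           P ⊆ SqRes c i → Q ⊆ SqRes c j → S ⊆ SqRes c k → T ⊆ SqRes c l →
           Sum4 P Q S T (+ c * M + + r) →
           (bit i ℕ.+ bit j ℕ.+ bit k ℕ.+ bit l) ℕ.% c ≡ r ℕ.% c
residue₄ c {i} {j} {k} {l} M r f g h e (sum4 p q s t eq)
  with t₁ , e₁ ← f p | t₂ , e₂ ← g q | t₃ , e₃ ← h s | t₄ , e₄ ← e t =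
  remainder-unique c (t₁ + t₂ + t₃ + t₄) M (bit i ℕ.+ bit j ℕ.+ bit k ℕ.+ bit l) r
    (sym (trans eq (trans (cong₂ _+_ (cong₂ _+_ (cong₂ _+_ e₁ e₂) e₃) e₄)
      (collect (+ c) t₁ t₂ t₃ t₄ (+ bit i) (+ bit j) (+ bit k) (+ bit l)))))
  where
  collect : ∀ c t₁ t₂ t₃ t₄ i j k l →
            (c * t₁ + i) + (c * t₂ + j) + (c * t₃ + k) + (c * t₄ + l) ≡
            c * (t₁ + t₂ + t₃ + t₄) + (i + j + k + l)
  collect = solve-∀

division : ∀ x c .{{_ : ℕ.NonZero c}} → x ≡ + c * (x ℤ./ℕ c) + + (x ℤ.%ℕ c)
division x c = trans (ℤ.a≡a%ℕn+[a/ℕn]*n x c)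
  (trans (ℤ.+-comm (+ (x ℤ.%ℕ c)) (x ℤ./ℕ c * + c)) (cong (_+ + (x ℤ.%ℕ c)) (ℤ.*-comm (x ℤ./ℕ c) (+ c))))

parity : ∀ x → ∃ λ b → Res 2 b x
parity x with x ℤ.%ℕ 2 | ℤ.n%ℕd<d x 2 | division x 2
... | 0 | _ | e = false , x ℤ./ℕ 2 , e
... | 1 | _ | e = true  , x ℤ./ℕ 2 , e
... | suc (suc _) | ℕ.s≤s (ℕ.s≤s ()) | _

neg² : ∀ x → - x * - x ≡ x * x
neg² = solve-∀

NonZero₃ : Pred ℤ 0ℓ
NonZero₃ x = One₃ x ⊎ One₃ (- x)

zero-or-nonZero₃ : ∀ x → Zero₃ x ⊎ NonZero₃ x
zero-or-nonZero₃ x with x ℤ.%ℕ 3 | ℤ.n%ℕd<d x 3 | division x 3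
... | 0 | _ | e = inj₁ (x ℤ./ℕ 3 , e)
... | 1 | _ | e = inj₂ (inj₁ (x ℤ./ℕ 3 , e))
... | 2 | _ | e = inj₂ (inj₂ (- (x ℤ./ℕ 3) - 1ℤ , trans (cong -_ e) (negate (x ℤ./ℕ 3))))
  where
  negate : ∀ q → - (+ 3 * q + + 2) ≡ + 3 * (- q - 1ℤ) + 1ℤ
  negate = solve-∀
... | suc (suc (suc _)) | ℕ.s≤s (ℕ.s≤s (ℕ.s≤s ())) | _

mod3-up-to-sign : Classifies (Res 3) U
mod3-up-to-sign x _ with zero-or-nonZero₃ x
... | inj₁ r        = false , x , r , refl
... | inj₂ (inj₁ r) = true , x , r , refl
... | inj₂ (inj₂ r) = true , - x , r , neg² x

parities : Sum4 P Q S T m →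
  Classified₄ (λ b → P ∩ Res 2 b) (λ b → Q ∩ Res 2 b) (λ b → S ∩ Res 2 b) (λ b → T ∩ Res 2 b) m
parities = classify₄ par par par par
  where
  par : ∀ {P} → Classifies (λ b → P ∩ Res 2 b) P
  par x p with b , r ← parity x = b , x , (p , r) , refl

-- Lagrange's four-square theorem

-- Multiplicativity of the quaternion norm, for the second quaternion times the conjugate of the
-- first; the real part is then the inner product.
euler : ∀ {k} → FourSquares m → FourSquares k → FourSquares (m * k)
euler (sum4 {a} {b} {c} {d} _ _ _ _ refl) (sum4 {x} {y} {z} {w} _ _ _ _ refl) =
  fourSquares (a * x + b * y + c * z + d * w) (a * y - b * x + c * w - d * z)
              (a * z - c * x + d * y - b * w) (a * w - d * x + b * z - c * y)
              (identity a b c d x y z w)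
  where
  identity : ∀ a b c d x y z w →
    (a * a + b * b + c * c + d * d) * (x * x + y * y + z * z + w * w) ≡
    (a * x + b * y + c * z + d * w) * (a * x + b * y + c * z + d * w) +
    (a * y - b * x + c * w - d * z) * (a * y - b * x + c * w - d * z) +
    (a * z - c * x + d * y - b * w) * (a * z - c * x + d * y - b * w) +
    (a * w - d * x + b * z - c * y) * (a * w - d * x + b * z - c * y)
  identity = solve-∀

double-cancel : ∀ {x y} → + 2 * x ≡ + 2 * y → x ≡ y
double-cancel {x} {y} = ℤ.*-cancelˡ-≡ (+ 2) x y

-- For x and y of equal parity, (x² + y²) / 2 = ((x + y) / 2)² + ((x - y) / 2)².
halve : ∀ {i j} → Sum4 (Res 2 i) (Res 2 i) (Res 2 j) (Res 2 j) (+ 2 * m) → FourSquares m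
halve {m} {i} {j} (sum4 {a} {b} {c} {d} (k , refl) (l , refl) (k′ , refl) (l′ , refl) eq) =
  fourSquares (k + l + + bit i) (k - l) (k′ + l′ + + bit j) (k′ - l′)
    (double-cancel (trans eq (identity k l k′ l′ (+ bit i) (+ bit j))))
  where
  identity : ∀ k l k′ l′ i j →
    (+ 2 * k + i) * (+ 2 * k + i) + (+ 2 * l + i) * (+ 2 * l + i) +
    (+ 2 * k′ + j) * (+ 2 * k′ + j) + (+ 2 * l′ + j) * (+ 2 * l′ + j) ≡
    + 2 * ((k + l + i) * (k + l + i) + (k - l) * (k - l) +
           (k′ + l′ + j) * (k′ + l′ + j) + (k′ - l′) * (k′ - l′))
  identity = solve-∀

-- An even sum has an even number of odd coordinates, and sorting places coordinates of equal parity
-- in adjacent pairs.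
FourSquares-halve : ∀ m → FourSquares (+ 2 * m) → FourSquares m
FourSquares-halve m r with sort₄ (classify₄ par par par par r)
  where
  par : Classifies (Res 2) U
  par x _ with b , p ← parity x = b , x , p , refl
... | four s = halve s
... | two s  = halve s
... | none s = halve s
... | three s with () ← residue₄ 2 m 0 (Res⇒SqRes 2) (Res⇒SqRes 2) (Res⇒SqRes 2) (Res⇒SqRes 2)
                         (subst (Sum4 _ _ _ _) (sym (ℤ.+-identityʳ _)) s)
... | one s with () ← residue₄ 2 m 0 (Res⇒SqRes 2) (Res⇒SqRes 2) (Res⇒SqRes 2) (Res⇒SqRes 2)
                         (subst (Sum4 _ _ _ _) (sym (ℤ.+-identityʳ _)) s)

parityℕ : ∀ n → ∃ λ h → n ≡ h ℕ.+ h ⊎ n ≡ suc (h ℕ.+ h)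
parityℕ zero = 0 , inj₁ refl
parityℕ (suc n) with parityℕ n
... | h , inj₁ refl = h , inj₂ refl
... | h , inj₂ refl = suc h , inj₁ (cong suc (sym (ℕ.+-suc h h)))

-- The last component encodes ∣ y ∣ ≤ h.
absolutely-least-residue : ∀ h x → ∃₂ λ q y → x ≡ + suc (h ℕ.+ h) * q + y × ∃ λ e → y * y + + e ≡ + h * + h
absolutely-least-residue h x
  -- Dividing `x + h` instead of `x` moves the remainders from 0, ..., 2h to -h, ..., h.
  with t ← (x + + h) ℤ.%ℕ suc (h ℕ.+ h) | ℕ.s≤s t≤2h ← ℤ.n%ℕd<d (x + + h) (suc (h ℕ.+ h))
     | q ← (x + + h) ℤ./ℕ suc (h ℕ.+ h) | e ← division (x + + h) (suc (h ℕ.+ h))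
  with s , t+s≡2h ← ℕ.m≤n⇒∃[o]m+o≡n t≤2h =
  q , + t - + h , from-difference 1ℤ e (shift x (+ h) (+ suc (h ℕ.+ h)) q (+ t)) ,
  -- With t + s = 2h, the slack h² - (t - h)² is t s.
  t ℕ.* s , trans (cong (λ z → (+ t - + h) * (+ t - + h) + z) (ℤ.pos-* t s))
     (from-difference (+ t) (cong +_ t+s≡2h) (square (+ t) (+ s) (+ h)))
  where
  shift : ∀ x h m q t → x - (m * q + (t - h)) ≡ 1ℤ * ((x + h) - (m * q + t))
  shift = solve-∀
  square : ∀ t s h → (t - h) * (t - h) + t * s - h * h ≡ t * (t + s - (h + h))
  square = solve-∀

square-∣∣ : ∀ x → x * x ≡ + (∣ x ∣ ℕ.* ∣ x ∣)
square-∣∣ (+ n) = sym (ℤ.pos-* n n)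
square-∣∣ -[1+ n ] = refl

sum-of-four-∣∣ : ∀ a b c d → a * a + b * b + c * c + d * d ≡
  + (∣ a ∣ ℕ.* ∣ a ∣ ℕ.+ ∣ b ∣ ℕ.* ∣ b ∣ ℕ.+ ∣ c ∣ ℕ.* ∣ c ∣ ℕ.+ ∣ d ∣ ℕ.* ∣ d ∣)
sum-of-four-∣∣ a b c d = cong₂ _+_ (cong₂ _+_ (cong₂ _+_ (square-∣∣ a) (square-∣∣ b)) (square-∣∣ c)) (square-∣∣ d)

∣x∣²≡0⇒x≡0 : ∀ {x} → ∣ x ∣ ℕ.* ∣ x ∣ ≡ 0 → x ≡ 0ℤ
∣x∣²≡0⇒x≡0 {x} e with ℕ.m*n≡0⇒m≡0∨n≡0 ∣ x ∣ e
... | inj₁ e = ℤ.∣i∣≡0⇒i≡0 e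
... | inj₂ e = ℤ.∣i∣≡0⇒i≡0 e

sum-of-four≡0 : ∀ a b c d → a * a + b * b + c * c + d * d ≡ 0ℤ → a ≡ 0ℤ × b ≡ 0ℤ × c ≡ 0ℤ × d ≡ 0ℤ
sum-of-four≡0 a b c d e =
  ∣x∣²≡0⇒x≡0 (ℕ.m+n≡0⇒m≡0 A abzero) , ∣x∣²≡0⇒x≡0 (ℕ.m+n≡0⇒n≡0 A abzero) ,
  ∣x∣²≡0⇒x≡0 (ℕ.m+n≡0⇒n≡0 (A ℕ.+ B) abczero) , ∣x∣²≡0⇒x≡0 (ℕ.m+n≡0⇒n≡0 (A ℕ.+ B ℕ.+ C) zero′)
  where
  A = ∣ a ∣ ℕ.* ∣ a ∣
  B = ∣ b ∣ ℕ.* ∣ b ∣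
  C = ∣ c ∣ ℕ.* ∣ c ∣
  D = ∣ d ∣ ℕ.* ∣ d ∣
  zero′ : A ℕ.+ B ℕ.+ C ℕ.+ D ≡ 0
  zero′ = ℤ.+-injective (trans (sym (sum-of-four-∣∣ a b c d)) e)
  abczero : A ℕ.+ B ℕ.+ C ≡ 0
  abczero = ℕ.m+n≡0⇒m≡0 (A ℕ.+ B ℕ.+ C) zero′
  abzero : A ℕ.+ B ≡ 0
  abzero = ℕ.m+n≡0⇒m≡0 (A ℕ.+ B) abczero

-- A negative `r` makes the product compute to a negative constructor, so that case is absent.
nonNegative-factor : ∀ k r n → + suc k * r ≡ + n → ∃ λ r′ → r ≡ + r′ × suc k ℕ.* r′ ≡ n
nonNegative-factor k (+ r) n e = r , refl , ℤ.+-injective (trans (ℤ.pos-* (suc k) r) e)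

-- Multiplying Σxᵢ² = m p by Σyᵢ² = m r, where yᵢ = xᵢ - m qᵢ, gives a sum of four
-- squares of multiples of m; dividing by m² yields this identity.
descent-identity : ∀ m q₁ q₂ q₃ q₄ y₁ y₂ y₃ y₄ p r →
  p ≡ m * (q₁ * q₁ + q₂ * q₂ + q₃ * q₃ + q₄ * q₄) + + 2 * (q₁ * y₁ + q₂ * y₂ + q₃ * y₃ + q₄ * y₄) + r →
  m * r ≡ y₁ * y₁ + y₂ * y₂ + y₃ * y₃ + y₄ * y₄ → FourSquares (r * p)
descent-identity m q₁ q₂ q₃ q₄ y₁ y₂ y₃ y₄ _ r refl mr≡ =
  fourSquares (q₁ * y₁ + q₂ * y₂ + q₃ * y₃ + q₄ * y₄ + r) (q₁ * y₂ - q₂ * y₁ + q₃ * y₄ - q₄ * y₃)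
              (q₁ * y₃ - q₃ * y₁ + q₄ * y₂ - q₂ * y₄) (q₁ * y₄ - q₄ * y₁ + q₂ * y₃ - q₃ * y₂)
    (from-difference (q₁ * q₁ + q₂ * q₂ + q₃ * q₃ + q₄ * q₄) mr≡
      (identity m q₁ q₂ q₃ q₄ y₁ y₂ y₃ y₄ r))
  where
  identity : ∀ m q₁ q₂ q₃ q₄ y₁ y₂ y₃ y₄ r →
    r * (m * (q₁ * q₁ + q₂ * q₂ + q₃ * q₃ + q₄ * q₄) + + 2 * (q₁ * y₁ + q₂ * y₂ + q₃ * y₃ + q₄ * y₄) + r) -
    ((q₁ * y₁ + q₂ * y₂ + q₃ * y₃ + q₄ * y₄ + r) * (q₁ * y₁ + q₂ * y₂ + q₃ * y₃ + q₄ * y₄ + r) +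
     (q₁ * y₂ - q₂ * y₁ + q₃ * y₄ - q₄ * y₃) * (q₁ * y₂ - q₂ * y₁ + q₃ * y₄ - q₄ * y₃) +
     (q₁ * y₃ - q₃ * y₁ + q₄ * y₂ - q₂ * y₄) * (q₁ * y₃ - q₃ * y₁ + q₄ * y₂ - q₂ * y₄) +
     (q₁ * y₄ - q₄ * y₁ + q₂ * y₃ - q₃ * y₂) * (q₁ * y₄ - q₄ * y₁ + q₂ * y₃ - q₃ * y₂)) ≡
    (q₁ * q₁ + q₂ * q₂ + q₃ * q₃ + q₄ * q₄) * (m * r - (y₁ * y₁ + y₂ * y₂ + y₃ * y₃ + y₄ * y₄))
  identity = solve-∀

-- 4h² < (2h + 1)². For an odd modulus all least residues are below half of it, which makes the new
-- multiplier strictly smaller; for an even modulus they may equal half of it, so even multipliers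
-- are halved instead.
bounded : ∀ h r e → suc (h ℕ.+ h) ℕ.* r ℕ.+ e ≡ 4 ℕ.* (h ℕ.* h) → r ℕ.< suc (h ℕ.+ h)
bounded h r e eq with r ℕ.<? suc (h ℕ.+ h)
... | yes r<m = r<m
... | no  r≮m with s , refl ← ℕ.m≤n⇒∃[o]m+o≡n (ℕ.≮⇒≥ r≮m) =
  contradiction (trans (sym eq) (expand h s e)) (ℕ.m≢1+m+n (4 ℕ.* (h ℕ.* h)))
  where
  expand : ∀ h s e → suc (h ℕ.+ h) ℕ.* (suc (h ℕ.+ h) ℕ.+ s) ℕ.+ e ≡
     suc (4 ℕ.* (h ℕ.* h) ℕ.+ (4 ℕ.* h ℕ.+ s ℕ.+ 2 ℕ.* h ℕ.* s ℕ.+ e))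
  expand = ℕ.solve-∀

descent-odd : ∀ h p → ¬ suc (h ℕ.+ h) ∣ p → FourSquares (+ suc (h ℕ.+ h) * + p) →
  ∃ λ r → 0 ℕ.< r × r ℕ.< suc (h ℕ.+ h) × FourSquares (+ r * + p)
descent-odd h p M∤p (sum4 {x₁} {x₂} {x₃} {x₄} _ _ _ _ Mp≡)
  with q₁ , y₁ , refl , e₁ , b₁ ← absolutely-least-residue h x₁
     | q₂ , y₂ , refl , e₂ , b₂ ← absolutely-least-residue h x₂
     | q₃ , y₃ , refl , e₃ , b₃ ← absolutely-least-residue h x₃
     | q₄ , y₄ , refl , e₄ , b₄ ← absolutely-least-residue h x₄ =
  conclude (nonNegative-factor (h ℕ.+ h) R N (trans MR≡Σyy Σyy≡N))
  where
  M = suc (h ℕ.+ h)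
  Σqq = q₁ * q₁ + q₂ * q₂ + q₃ * q₃ + q₄ * q₄
  Σqy = q₁ * y₁ + q₂ * y₂ + q₃ * y₃ + q₄ * y₄
  Σyy = y₁ * y₁ + y₂ * y₂ + y₃ * y₃ + y₄ * y₄
  -- Expanding M p = Σ (M q + y)² gives Σyy = M R.
  R = + p - + M * Σqq - + 2 * Σqy

  MR≡Σyy : + M * R ≡ Σyy
  MR≡Σyy = from-difference 1ℤ Mp≡ (identity (+ M) (+ p) q₁ q₂ q₃ q₄ y₁ y₂ y₃ y₄)
    where
    identity : ∀ m p q₁ q₂ q₃ q₄ y₁ y₂ y₃ y₄ →
      m * (p - m * (q₁ * q₁ + q₂ * q₂ + q₃ * q₃ + q₄ * q₄) - + 2 * (q₁ * y₁ + q₂ * y₂ + q₃ * y₃ + q₄ * y₄)) -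
      (y₁ * y₁ + y₂ * y₂ + y₃ * y₃ + y₄ * y₄) ≡
      1ℤ * (m * p - ((m * q₁ + y₁) * (m * q₁ + y₁) + (m * q₂ + y₂) * (m * q₂ + y₂) +
                     (m * q₃ + y₃) * (m * q₃ + y₃) + (m * q₄ + y₄) * (m * q₄ + y₄)))
    identity = solve-∀

  p≡ : + p ≡ + M * Σqq + + 2 * Σqy + R
  p≡ = identity (+ p) (+ M * Σqq) (+ 2 * Σqy)
    where
    identity : ∀ p a b → p ≡ a + b + (p - a - b)
    identity = solve-∀

  N = ∣ y₁ ∣ ℕ.* ∣ y₁ ∣ ℕ.+ ∣ y₂ ∣ ℕ.* ∣ y₂ ∣ ℕ.+ ∣ y₃ ∣ ℕ.* ∣ y₃ ∣ ℕ.+ ∣ y₄ ∣ ℕ.* ∣ y₄ ∣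

  Σyy≡N : Σyy ≡ + N
  Σyy≡N = sum-of-four-∣∣ y₁ y₂ y₃ y₄

  N-bound : N ℕ.+ (e₁ ℕ.+ e₂ ℕ.+ e₃ ℕ.+ e₄) ≡ 4 ℕ.* (h ℕ.* h)
  N-bound = ℤ.+-injective (trans (cong (_+ + (e₁ ℕ.+ e₂ ℕ.+ e₃ ℕ.+ e₄)) (sym Σyy≡N))
    (trans (regroup (y₁ * y₁) (y₂ * y₂) (y₃ * y₃) (y₄ * y₄) (+ e₁) (+ e₂) (+ e₃) (+ e₄))
    (trans (cong₂ _+_ (cong₂ _+_ (cong₂ _+_ b₁ b₂) b₃) b₄)
    (trans (quadruple (+ h * + h)) (trans (cong (+ 4 *_) (sym (ℤ.pos-* h h))) (sym (ℤ.pos-* 4 (h ℕ.* h))))))))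
    where
    regroup : ∀ a b c d e f g i → a + b + c + d + (e + f + g + i) ≡ a + e + (b + f) + (c + g) + (d + i)
    regroup = solve-∀
    quadruple : ∀ a → a + a + a + a ≡ + 4 * a
    quadruple = solve-∀

  conclude : (∃ λ r → R ≡ + r × M ℕ.* r ≡ N) → ∃ λ r → 0 ℕ.< r × r ℕ.< M × FourSquares (+ r * + p)
  -- If all residues vanish, M p is divisible by M², hence M divides p.
  conclude (zero , R≡0 , M0≡N) = contradiction M∣p M∤p
    where
    all-zero : y₁ ≡ 0ℤ × y₂ ≡ 0ℤ × y₃ ≡ 0ℤ × y₄ ≡ 0ℤ
    all-zero = sum-of-four≡0 y₁ y₂ y₃ y₄
      (trans Σyy≡N (cong +_ (trans (sym M0≡N) (ℕ.*-zeroʳ M))))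

    p≡MΣqq : + p ≡ + M * Σqq
    p≡MΣqq with y₁≡0 , y₂≡0 , y₃≡0 , y₄≡0 ← all-zero =
      trans p≡ (trans (cong₂ (λ Σqy R → + M * Σqq + + 2 * Σqy + R) Σqy≡0 R≡0) (drop-zeros (+ M * Σqq)))
      where
      drop-zeros : ∀ a → a + + 2 * 0ℤ + 0ℤ ≡ a
      drop-zeros = solve-∀
      zeros : ∀ q₁ q₂ q₃ q₄ → q₁ * 0ℤ + q₂ * 0ℤ + q₃ * 0ℤ + q₄ * 0ℤ ≡ 0ℤ
      zeros = solve-∀
      Σqy≡0 : Σqy ≡ 0ℤ
      Σqy≡0 = trans (cong₂ _+_ (cong₂ _+_ (cong₂ _+_ (cong (q₁ *_) y₁≡0) (cong (q₂ *_) y₂≡0))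
                             (cong (q₃ *_) y₃≡0)) (cong (q₄ *_) y₄≡0)) (zeros q₁ q₂ q₃ q₄)

    M∣p : M ∣ p
    M∣p = let q , _ , Mq≡p = nonNegative-factor (h ℕ.+ h) Σqq p (sym p≡MΣqq) in
      divides q (trans (sym Mq≡p) (ℕ.*-comm M q))
  conclude (r@(suc _) , R≡r , Mr≡N) =
    r , ℕ.z<s , bounded h r (e₁ ℕ.+ e₂ ℕ.+ e₃ ℕ.+ e₄) (trans (cong (ℕ._+ (e₁ ℕ.+ e₂ ℕ.+ e₃ ℕ.+ e₄)) Mr≡N) N-bound) ,
    descent-identity (+ M) q₁ q₂ q₃ q₄ y₁ y₂ y₃ y₄ (+ p) (+ r)
      (subst (λ R → + p ≡ + M * Σqq + + 2 * Σqy + R) R≡r p≡) (subst (λ R → + M * R ≡ Σyy) R≡r MR≡Σyy)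

descent : ∀ p → Prime p → ∀ m → 0 ℕ.< m → m ℕ.< p → FourSquares (+ m * + p) → FourSquares (+ p)
descent p prime-p = <-rec _ step
  where
  proper : ∀ {m} → suc (suc m) ℕ.< p → ¬ suc (suc m) ∣ p
  proper m<p m∣p with prime⇒irreducible prime-p m∣p
  -- The only divisors of a prime are 1 and the prime itself, and the multiplier lies strictly
  -- between them.
  ... | inj₂ refl = ℕ.<-irrefl refl m<p
  double : ∀ h p → (h + h) * p ≡ + 2 * (h * p)
  double = solve-∀
  step : ∀ m → (∀ {k} → k ℕ.< m → 0 ℕ.< k → k ℕ.< p → FourSquares (+ k * + p) → FourSquares (+ p)) →
         0 ℕ.< m → m ℕ.< p → FourSquares (+ m * + p) → FourSquares (+ p)
  step m rec 0<m m<p r with parityℕ m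
  step _ rec () m<p r | zero  , inj₁ refl
  step _ rec 0<m m<p r | suc h , inj₁ refl =
    rec (ℕ.m<m+n (suc h) ℕ.z<s) ℕ.z<s (ℕ.<-trans (ℕ.m<m+n (suc h) ℕ.z<s) m<p)
      (FourSquares-halve (+ suc h * + p) (subst FourSquares (double (+ suc h) (+ p)) r))
  step _ rec 0<m m<p r | zero  , inj₂ refl = subst FourSquares (ℤ.*-identityˡ (+ p)) r
  step _ rec 0<m m<p r | suc h , inj₂ refl
    with k , 0<k , k<m , r′ ← descent-odd (suc h) p (proper m<p) r =
    rec k<m 0<k (ℕ.<-trans k<m m<p) r′

-- j² - i² = (j - i)(j + i), and both factors lie strictly between 0 and `p` because i < j and both
-- are at most h; Euclid's lemma applies.
square-injective : ∀ {p h i j} K → Prime p → p ≡ suc (h ℕ.+ h) → i ℕ.≤ h → j ℕ.≤ h → i ℕ.< j →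
                   + j * + j - + i * + i ≢ K * + p
square-injective {p} {h} {i} {j} K prime-p refl i≤h j≤h i<j eq
  with d , refl ← ℕ.m≤n⇒∃[o]m+o≡n i<j = impossible
  where
  factor : ∀ i d → (1ℤ + i + d) * (1ℤ + i + d) - i * i ≡ (1ℤ + d) * (1ℤ + i + d + i)
  factor = solve-∀
  product : suc d ℕ.* (suc (i ℕ.+ d) ℕ.+ i) ≡ ∣ K ∣ ℕ.* p
  product = trans (cong ∣_∣ (trans (ℤ.pos-* (suc d) _) (trans (sym (factor (+ i) (+ d))) eq))) (ℤ.abs-* K (+ p))
  impossible : _
  impossible with euclidsLemma (suc d) (suc (i ℕ.+ d) ℕ.+ i) prime-p (divides ∣ K ∣ product)
  ... | inj₁ p∣ = ℕ.<-irrefl refl (ℕ.<-≤-trans (ℕ.s≤s (ℕ.≤-trans (ℕ.s≤s (ℕ.m≤n+m d i)) (ℕ.≤-trans j≤h (ℕ.m≤m+n h h)))) (∣⇒≤ p∣))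
  ... | inj₂ p∣ = ℕ.<-irrefl refl (ℕ.<-≤-trans (ℕ.s≤s (ℕ.+-mono-≤ j≤h i≤h)) (∣⇒≤ p∣))

congruent : ∀ p .{{_ : ℕ.NonZero p}} x y → x ℤ.%ℕ p ≡ y ℤ.%ℕ p → ∃ λ K → x - y ≡ K * + p
congruent p x y eq = x ℤ./ℕ p - y ℤ./ℕ p , trans (cong₂ _-_ (ℤ.a≡a%ℕn+[a/ℕn]*n x p) (ℤ.a≡a%ℕn+[a/ℕn]*n y p))
  (trans (cong (λ r → + r + x ℤ./ℕ p * + p - (+ (y ℤ.%ℕ p) + y ℤ./ℕ p * + p)) eq)
   (identity (+ (y ℤ.%ℕ p)) (x ℤ./ℕ p) (y ℤ./ℕ p) (+ p)))
  where
  identity : ∀ r a b p → r + a * p - (r + b * p) ≡ (a - b) * p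
  identity = solve-∀

-- Pigeonhole on the h + 1 residues of x² and the h + 1 residues of - 1 - y².
two-squares-plus-one : ∀ {p} h → Prime p → p ≡ suc (h ℕ.+ h) →
  ∃₂ λ x y → ∃ λ k → x ℕ.≤ h × y ℕ.≤ h × + x * + x + + y * + y + 1ℤ ≡ k * + p
two-squares-plus-one {p} h prime-p refl =
  let i , j , i<j , hᵢ≡hⱼ = pigeonhole more hash in
  collide (splitAt (suc h) i) (splitAt (suc h) j)
    (λ e → ℕ.<-irrefl (cong toℕ (splitAt-injective e)) i<j) hᵢ≡hⱼ
  where
  residue : ℤ → Fin p
  residue x = fromℕ< (ℤ.n%ℕd<d x p)
  value : Fin (suc h) ⊎ Fin (suc h) → ℤ
  value (inj₁ i) = + toℕ i * + toℕ i
  value (inj₂ j) = - 1ℤ - + toℕ j * + toℕ j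
  hash : Fin (suc h ℕ.+ suc h) → Fin p
  hash i = residue (value (splitAt (suc h) i))
  more : p ℕ.< suc h ℕ.+ suc h
  more = ℕ.≤-reflexive (cong suc (sym (ℕ.+-suc h h)))
  splitAt-injective : ∀ {i j} → splitAt (suc h) i ≡ splitAt (suc h) j → i ≡ j
  splitAt-injective {i} {j} e = trans (sym (join-splitAt (suc h) (suc h) i))
    (trans (cong (join (suc h) (suc h)) e) (join-splitAt (suc h) (suc h) j))
  value-congruent : ∀ s t → residue (value s) ≡ residue (value t) → ∃ λ K → value s - value t ≡ K * + p
  value-congruent s t e = congruent p (value s) (value t)
    (trans (sym (toℕ-fromℕ< _)) (trans (cong toℕ e) (toℕ-fromℕ< _)))
  ≤h : ∀ (i : Fin (suc h)) → toℕ i ℕ.≤ h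
  ≤h i = ℕ.≤-pred (toℕ<n i)
  negate : ∀ i j K p → i * i - j * j ≡ K * p → j * j - i * i ≡ - K * p
  negate i j K p e = from-difference (- 1ℤ) e (identity i j K p)
    where
    identity : ∀ i j k p → j * j - i * i - (- k * p) ≡ - 1ℤ * (i * i - j * j - k * p)
    identity = solve-∀
  distinct : ∀ (i j : Fin (suc h)) K → i ≢ j → + toℕ i * + toℕ i - + toℕ j * + toℕ j ≢ K * + p
  distinct i j K i≢j e with ℕ.<-cmp (toℕ i) (toℕ j)
  ... | tri< i<j _ _ = square-injective (- K) prime-p refl (≤h i) (≤h j) i<j
                         (negate (+ toℕ i) (+ toℕ j) K (+ p) e)
  ... | tri≈ _ i≡j _ = i≢j (toℕ-injective i≡j)
  ... | tri> _ _ j<i = square-injective K prime-p refl (≤h j) (≤h i) j<i e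
  shift : ∀ i j k → - 1ℤ - i * i - (- 1ℤ - j * j) ≡ k → j * j - i * i ≡ k
  shift i j k e = from-difference 1ℤ e (identity i j k)
    where
    identity : ∀ i j k → j * j - i * i - k ≡ 1ℤ * (- 1ℤ - i * i - (- 1ℤ - j * j) - k)
    identity = solve-∀
  combine : ∀ i j → i * i + j * j + 1ℤ ≡ i * i - (- 1ℤ - j * j)
  combine = solve-∀
  -- Values of the same kind are incongruent by `square-injective`, so the collision is between
  -- kinds: x² ≡ - 1 - y² modulo p.
  collide : ∀ s t → s ≢ t → residue (value s) ≡ residue (value t) →
    ∃₂ λ x y → ∃ λ k → x ℕ.≤ h × y ℕ.≤ h × + x * + x + + y * + y + 1ℤ ≡ k * + p
  collide (inj₁ i) (inj₁ j) s≢t e =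
    let K , e′ = value-congruent (inj₁ i) (inj₁ j) e in
    contradiction e′ (distinct i j K (λ i≡j → s≢t (cong inj₁ i≡j)))
  collide (inj₂ i) (inj₂ j) s≢t e =
    let K , e′ = value-congruent (inj₂ i) (inj₂ j) e in
    contradiction (shift (+ toℕ i) (+ toℕ j) (K * + p) e′)
      (distinct j i K (λ j≡i → s≢t (cong inj₂ (sym j≡i))))
  collide (inj₁ i) (inj₂ j) _ e =
    let K , e′ = value-congruent (inj₁ i) (inj₂ j) e in
    toℕ i , toℕ j , K , ≤h i , ≤h j , trans (combine (+ toℕ i) (+ toℕ j)) e′
  collide (inj₂ i) (inj₁ j) s≢t e = collide (inj₁ j) (inj₂ i) (λ t≡s → s≢t (sym t≡s)) (sym e)

prime⇒FourSquares : ∀ p → Prime p → FourSquares (+ p)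
prime⇒FourSquares p prime-p with parityℕ p
-- An even prime has the divisor 2, hence is 2 = 1² + 1².
... | h , inj₁ refl with prime⇒irreducible prime-p (divides h (trans (sym (cong (h ℕ.+_) (ℕ.+-identityʳ h))) (ℕ.*-comm 2 h)))
...   | inj₂ 2≡p = subst (λ n → FourSquares (+ n)) 2≡p (fourSquares 1ℤ 1ℤ 0ℤ 0ℤ refl)
prime⇒FourSquares p prime-p | h , inj₂ refl
  with x , y , k , x≤h , y≤h , eq ← two-squares-plus-one h prime-p refl
  with nonNegative-factor (h ℕ.+ h) k (suc (x ℕ.* x ℕ.+ y ℕ.* y))
         (trans (ℤ.*-comm (+ suc (h ℕ.+ h)) k) (trans (sym eq)
           (trans (cong₂ (λ a b → a + b + 1ℤ) (sym (ℤ.pos-* x x)) (sym (ℤ.pos-* y y))) (cong +_ (ℕ.+-comm _ 1)))))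
... | zero , _ , e = contradiction (trans (sym (ℕ.*-zeroʳ (suc (h ℕ.+ h)))) e) λ ()
... | suc k′ , refl , e =
  descent p prime-p (suc k′) ℕ.z<s k<p
    (fourSquares (+ x) (+ y) 1ℤ 0ℤ (trans (sym eq) (add-zero (+ x) (+ y))))
  where
  add-zero : ∀ x y → x * x + y * y + 1ℤ ≡ x * x + y * y + 1ℤ * 1ℤ + 0ℤ * 0ℤ
  add-zero = solve-∀
  x²+y²≤2h² : x ℕ.* x ℕ.+ y ℕ.* y ℕ.≤ h ℕ.* h ℕ.+ h ℕ.* h
  x²+y²≤2h² = ℕ.+-mono-≤ (ℕ.*-mono-≤ x≤h x≤h) (ℕ.*-mono-≤ y≤h y≤h)
  -- k p = x² + y² + 1 ≤ 2h² + 1 < p²: the bounds x, y ≤ h are what lets the descent start.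
  k<p : suc k′ ℕ.< p
  k<p = ℕ.*-cancelˡ-< p (suc k′) p (ℕ.≤-<-trans (ℕ.≤-trans (ℕ.≤-reflexive e) (ℕ.s≤s x²+y²≤2h²)) gap)
    where
    expand : ∀ h → suc (h ℕ.+ h) ℕ.* suc (h ℕ.+ h) ≡ suc (h ℕ.* h ℕ.+ h ℕ.* h) ℕ.+ (2 ℕ.* (h ℕ.* h) ℕ.+ 4 ℕ.* h)
    expand = ℕ.solve-∀
    positive : ∀ h → Prime (suc (h ℕ.+ h)) → 0 ℕ.< h
    positive zero    prime-1 = contradiction prime-1 ¬prime[1]
    positive (suc _) _       = ℕ.z<s
    gap : suc (h ℕ.* h ℕ.+ h ℕ.* h) ℕ.< p ℕ.* p
    gap = subst (suc (h ℕ.* h ℕ.+ h ℕ.* h) ℕ.<_) (sym (expand h))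
      (ℕ.m<m+n _ (ℕ.<-≤-trans (ℕ.<-≤-trans (positive h prime-p) (ℕ.m≤n*m h 4)) (ℕ.m≤n+m (4 ℕ.* h) (2 ℕ.* (h ℕ.* h)))))

lagrange : ∀ n → FourSquares (+ n)
lagrange = <-rec _ step
  where
  step : ∀ n → (∀ {k} → k ℕ.< n → FourSquares (+ k)) → FourSquares (+ n)
  step 0 _ = fourSquares 0ℤ 0ℤ 0ℤ 0ℤ refl
  step 1 _ = fourSquares 1ℤ 0ℤ 0ℤ 0ℤ refl
  step n@(suc (suc _)) rec with prime? n
  ... | yes prime-n = prime⇒FourSquares n prime-n
  ... | no ¬prime-n with composite {d} d<n d∣n ← ¬prime⇒composite ¬prime-n =
    subst FourSquares (trans (sym (ℤ.pos-* (quotient d∣n) d)) (cong +_ (sym (_∣_.equality d∣n))))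
      (euler (rec (quotient-< d∣n)) (rec d<n))

-- Four squares modulo 3

-- Rules out x² + 0² + 0² + 0², where rotating the three zeros changes nothing.
SquareOtherThan : ℤ → Pred ℤ 0ℓ
SquareOtherThan m x = x * x ≢ m

ProperFourSquares : ℤ → Set
ProperFourSquares m = Sum4 (SquareOtherThan m) (SquareOtherThan m) (SquareOtherThan m) (SquareOtherThan m) m

nonzero-first : m ≢ 0ℤ → Sum4 P P P P m → Sum4 (P ∩ (_≢ 0ℤ)) P P P m
nonzero-first m≢0 (sum4 {a} {b} {c} {d} pa pb pc pd eq)
  with a ℤ.≟ 0ℤ | b ℤ.≟ 0ℤ | c ℤ.≟ 0ℤ | d ℤ.≟ 0ℤ
... | no a≢0   | _        | _        | _        = sum4 (pa , a≢0) pb pc pd eq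
... | yes _    | no b≢0   | _        | _        = swap₁₂ (sum4 pa (pb , b≢0) pc pd eq)
... | yes _    | yes _    | no c≢0   | _        = swap₁₂ (swap₂₃ (sum4 pa pb (pc , c≢0) pd eq))
... | yes _    | yes _    | yes _    | no d≢0   = swap₁₂ (swap₂₃ (swap₃₄ (sum4 pa pb pc (pd , d≢0) eq)))
... | yes refl | yes refl | yes refl | yes refl = contradiction eq m≢0

-- The square of the quaternion a + bi + cj + dk.
odd-square-proper : ∀ {k} → Odd k → ProperFourSquares k → ProperFourSquares (k * k)
odd-square-proper {k} odd@(j , refl) r
  with nonzero-first (λ k≡0 → contradiction (remainder-unique 2 j 0ℤ 1 0 k≡0) λ ()) r
... | sum4 {a} {b} {c} {d} (a²≢k , a≢0) _ _ _ eq =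
  -- The real part a² - b² - c² - d² is 2a² - k, as the norm is k.
  sum4 {a = + 2 * (a * a) - k} {+ 2 * (a * b)} {+ 2 * (a * c)} {+ 2 * (a * d)}
    first (even b) (even c) (even d) (from-difference (+ 4 * (a * a)) eq (identity k a b c d))
  where
  identity : ∀ k a b c d →
    k * k - ((+ 2 * (a * a) - k) * (+ 2 * (a * a) - k) + (+ 2 * (a * b)) * (+ 2 * (a * b)) +
             (+ 2 * (a * c)) * (+ 2 * (a * c)) + (+ 2 * (a * d)) * (+ 2 * (a * d))) ≡
    + 4 * (a * a) * (k - (a * a + b * b + c * c + d * d))
  identity = solve-∀
  -- An even number does not square to the odd k².
  even : ∀ b → SquareOtherThan (k * k) (+ 2 * (a * b))
  even b e = contradiction
    (remainder-unique 2 (+ 2 * (a * b) * (a * b)) (+ 2 * (j * j) + + 2 * j) 0 1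
      (trans (left (a * b)) (trans e (right j)))) λ ()
    where
    left : ∀ x → + 2 * (+ 2 * x * x) + 0ℤ ≡ + 2 * x * (+ 2 * x)
    left = solve-∀
    right : ∀ j → (+ 2 * j + 1ℤ) * (+ 2 * j + 1ℤ) ≡ + 2 * (+ 2 * (j * j) + + 2 * j) + 1ℤ
    right = solve-∀
  difference : ∀ a k → + 4 * (a * a * (a * a - k)) - 0ℤ ≡
                       1ℤ * ((+ 2 * (a * a) - k) * (+ 2 * (a * a) - k) - k * k)
  difference = solve-∀
  a≢0-square : a * a ≢ 0ℤ
  a≢0-square a²≡0 = [ a≢0 , a≢0 ]′ (ℤ.i*j≡0⇒i≡0∨j≡0 a a²≡0)
  -- (2a² - k)² - k² = 4a² (a² - k). This is why the representation of `k` must itself be proper and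
  -- its first coordinate nonzero.
  first : SquareOtherThan (k * k) (+ 2 * (a * a) - k)
  first e = [ a≢0-square , (λ a²-k≡0 → a²≢k (ℤ.i-j≡0⇒i≡j (a * a) k a²-k≡0)) ]′
    (ℤ.i*j≡0⇒i≡0∨j≡0 (a * a)
      (ℤ.*-cancelˡ-≡ (+ 4) (a * a * (a * a - k)) 0ℤ (from-difference 1ℤ e (difference a k))))

-- An even k needs no quaternions: k² is four times (k / 2)².
even-square-proper : ∀ h → ProperFourSquares (+ (suc h ℕ.+ suc h) * + (suc h ℕ.+ suc h))
even-square-proper h = sum4 {a = + suc h} {+ suc h} {+ suc h} {+ suc h} proper proper proper proper (double (+ suc h))
  where
  double : ∀ h → (h + h) * (h + h) ≡ h * h + h * h + h * h + h * h
  double = solve-∀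
  proper : SquareOtherThan (+ (suc h ℕ.+ suc h) * + (suc h ℕ.+ suc h)) (+ suc h)
  proper e = contradiction (ℤ.+-injective e) (ℕ.<⇒≢ (ℕ.*-mono-< h<2h h<2h))
    where
    h<2h : suc h ℕ.< suc h ℕ.+ suc h
    h<2h = ℕ.m<m+n (suc h) ℕ.z<s

-- A representation that is not proper exhibits `n` as a square k², and for odd k ≥ 3 the induction
-- hypothesis is available at k < k². The bound excludes 0 and 1, which have no proper
-- representation.
2≤n⇒ProperFourSquares : ∀ n → 2 ℕ.≤ n → ProperFourSquares (+ n)
2≤n⇒ProperFourSquares = <-rec _ step
  where
  Goal : ℕ → Set
  Goal n = 2 ℕ.≤ n → ProperFourSquares (+ n)

  odd : ∀ h → Odd (+ suc (suc h ℕ.+ suc h))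
  odd h = + suc h , identity (+ suc h)
    where
    identity : ∀ h → 1ℤ + (h + h) ≡ + 2 * h + 1ℤ
    identity = solve-∀

  square : ∀ k → (∀ {i} → i ℕ.< k ℕ.* k → Goal i) → Goal (k ℕ.* k)
  square k rec 2≤k² with parityℕ k
  square _ rec ()      | zero  , inj₁ refl
  square _ rec _       | suc h , inj₁ refl = even-square-proper h
  square _ rec (ℕ.s≤s ()) | zero , inj₂ refl
  square _ rec 2≤k²    | suc h , inj₂ refl =
    odd-square-proper (odd h) (rec (ℕ.m<m*n _ _ (ℕ.s≤s ℕ.z<s)) (ℕ.s≤s (ℕ.s≤s ℕ.z≤n)))

  step : ∀ n → (∀ {k} → k ℕ.< n → Goal k) → Goal n
  step n rec 2≤n with lagrange n
  ... | sum4 {a} {b} {c} {d} _ _ _ _ eq with isSquare a | isSquare b | isSquare c | isSquare d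
    where
    isSquare : ∀ x → (SquareOtherThan (+ n) x) ⊎ ∃ λ k → k ℕ.* k ≡ n
    isSquare x with x * x ℤ.≟ + n
    ... | yes e = inj₂ (∣ x ∣ , ℤ.+-injective (trans (sym (square-∣∣ x)) e))
    ... | no ne = inj₁ ne
  ... | inj₁ na | inj₁ nb | inj₁ nc | inj₁ nd = sum4 {a = a} {b} {c} {d} na nb nc nd eq
  ... | inj₂ (k , refl) | _ | _ | _ = square k rec 2≤n
  ... | _ | inj₂ (k , refl) | _ | _ = square k rec 2≤n
  ... | _ | _ | inj₂ (k , refl) | _ = square k rec 2≤n
  ... | _ | _ | _ | inj₂ (k , refl) = square k rec 2≤n

data Sum3 (P Q S : Pred ℤ 0ℓ) (m : ℤ) : Set where
  sum3 : ∀ {a b c} → P a → Q b → S c → m ≡ a * a + b * b + c * c → Sum3 P Q S m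

-- 3(a, b, c) reflected in the plane orthogonal to (1, 1, 1).
rotate : ∀ a b c → One₃ (a + b + c) → Sum3 One₃ One₃ One₃ (+ 9 * (a * a + b * b + c * c))
rotate a b c (k , s≡) =
  sum3 (coordinate a) (coordinate b) (coordinate c) (identity a b c)
  where
  s = a + b + c
  -- Modulo 3, 3x - 2s ≡ s ≡ 1.
  coordinate : ∀ x → One₃ (+ 3 * x - + 2 * s)
  coordinate x = x - + 2 * k - 1ℤ , from-difference (- + 2) s≡ (difference x s k)
    where
    difference : ∀ x s k → + 3 * x - + 2 * s - (+ 3 * (x - + 2 * k - 1ℤ) + 1ℤ) ≡ - + 2 * (s - (+ 3 * k + 1ℤ))
    difference = solve-∀
  identity : ∀ a b c → + 9 * (a * a + b * b + c * c) ≡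
    (+ 3 * a - + 2 * (a + b + c)) * (+ 3 * a - + 2 * (a + b + c)) +
    (+ 3 * b - + 2 * (a + b + c)) * (+ 3 * b - + 2 * (a + b + c)) +
    (+ 3 * c - + 2 * (a + b + c)) * (+ 3 * c - + 2 * (a + b + c))
  identity = solve-∀

-- The signs are free. As soon as one coordinate is prime to 3 they can be chosen to make the sum 1
-- modulo 3: 1 + 1 - 1, - 1 - 1 - 0 and 1 + 0 + 0 are the three patterns used below.
rotate-up-to-sign : ∀ a b c a′ b′ c′ → a′ * a′ ≡ a * a → b′ * b′ ≡ b * b → c′ * c′ ≡ c * c →
  One₃ (a′ + b′ + c′) → m ≡ a * a + b * b + c * c → Sum3 One₃ One₃ One₃ (+ 9 * m)
rotate-up-to-sign a b c a′ b′ c′ ea eb ec r e =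
  subst (Sum3 One₃ One₃ One₃) (cong (+ 9 *_) (trans (cong₂ _+_ (cong₂ _+_ ea eb) ec) (sym e)))
    (rotate a′ b′ c′ r)

rotate-three : ∀ a b c → One₃ a → One₃ b → One₃ c → m ≡ a * a + b * b + c * c → Sum3 One₃ One₃ One₃ (+ 9 * m)
rotate-three a b c (k , refl) (l , refl) (j , refl) =
  rotate-up-to-sign a b c a b (- c) refl refl (neg² c) (k + l - j , identity k l j)
  where
  identity : ∀ k l j → (+ 3 * k + 1ℤ) + (+ 3 * l + 1ℤ) + - (+ 3 * j + 1ℤ) ≡ + 3 * (k + l - j) + 1ℤ
  identity = solve-∀

rotate-two : ∀ a b c → One₃ a → One₃ b → Zero₃ c → m ≡ a * a + b * b + c * c → Sum3 One₃ One₃ One₃ (+ 9 * m)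
rotate-two a b c (k , refl) (l , refl) (j , refl) =
  rotate-up-to-sign a b c (- a) (- b) (- c) (neg² a) (neg² b) (neg² c) (- k - l - j - 1ℤ , identity k l j)
  where
  identity : ∀ k l j → - (+ 3 * k + 1ℤ) + - (+ 3 * l + 1ℤ) + - (+ 3 * j + 0ℤ) ≡ + 3 * (- k - l - j - 1ℤ) + 1ℤ
  identity = solve-∀

rotate-one : ∀ a b c → One₃ a → Zero₃ b → Zero₃ c → m ≡ a * a + b * b + c * c → Sum3 One₃ One₃ One₃ (+ 9 * m)
rotate-one a b c (k , refl) (l , refl) (j , refl) =
  rotate-up-to-sign a b c a b c refl refl refl (k + l + j , identity k l j)
  where
  identity : ∀ k l j → (+ 3 * k + 1ℤ) + (+ 3 * l + 0ℤ) + (+ 3 * j + 0ℤ) ≡ + 3 * (k + l + j) + 1ℤ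
  identity = solve-∀

sum-of-three-∣∣ : ∀ a b c → a * a + b * b + c * c ≡
  + (∣ a ∣ ℕ.* ∣ a ∣ ℕ.+ ∣ b ∣ ℕ.* ∣ b ∣ ℕ.+ ∣ c ∣ ℕ.* ∣ c ∣)
sum-of-three-∣∣ a b c = cong₂ _+_ (cong₂ _+_ (square-∣∣ a) (square-∣∣ b)) (square-∣∣ c)

sum-of-tripled-squares : ∀ a b c → (+ 3 * a + 0ℤ) * (+ 3 * a + 0ℤ) + (+ 3 * b + 0ℤ) * (+ 3 * b + 0ℤ) +
  (+ 3 * c + 0ℤ) * (+ 3 * c + 0ℤ) ≡ + 9 * (a * a + b * b + c * c)
sum-of-tripled-squares = solve-∀

-- If all three coordinates are divisible by 3, then n = 9n′. Induction at n′ rewrites `n` itself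
-- with three coordinates that are 1 modulo 3, and one more rotation gives 9n.
nine-times : ∀ n → n ≢ 0 → ∀ a b c → + n ≡ a * a + b * b + c * c → Sum3 One₃ One₃ One₃ (+ 9 * + n)
nine-times = <-rec _ step
  where
  Goal : ℕ → Set
  Goal n = n ≢ 0 → ∀ a b c → + n ≡ a * a + b * b + c * c → Sum3 One₃ One₃ One₃ (+ 9 * + n)

  step : ∀ n → (∀ {k} → k ℕ.< n → Goal k) → Goal n
  step n rec n≢0 a b c eq
    with i , a , ra , ea ← mod3-up-to-sign a tt
       | j , b , rb , eb ← mod3-up-to-sign b tt
       | k , c , rc , ec ← mod3-up-to-sign c tt =
    by-residues i j k a b c ra rb rc (trans eq (sym (cong₂ _+_ (cong₂ _+_ ea eb) ec)))
    where
    swap-ab : ∀ a b c → a * a + b * b + c * c ≡ b * b + a * a + c * c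
    swap-ab = solve-∀
    swap-bc : ∀ a b c → a * a + b * b + c * c ≡ a * a + c * c + b * b
    swap-bc = solve-∀
    swap-ac : ∀ a b c → a * a + b * b + c * c ≡ c * c + b * b + a * a
    swap-ac = solve-∀
    by-residues : ∀ i j k a b c → Res 3 i a → Res 3 j b → Res 3 k c → + n ≡ a * a + b * b + c * c →
                  Sum3 One₃ One₃ One₃ (+ 9 * + n)
    by-residues true  true  true  a b c ra rb rc e = rotate-three a b c ra rb rc e
    by-residues true  true  false a b c ra rb rc e = rotate-two a b c ra rb rc e
    by-residues true  false true  a b c ra rb rc e = rotate-two a c b ra rc rb (trans e (swap-bc a b c))
    by-residues false true  true  a b c ra rb rc e = rotate-two c b a rc rb ra (trans e (swap-ac a b c))
    by-residues true  false false a b c ra rb rc e = rotate-one a b c ra rb rc e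
    by-residues false true  false a b c ra rb rc e = rotate-one b a c rb ra rc (trans e (swap-ab a b c))
    by-residues false false true  a b c ra rb rc e = rotate-one c b a rc rb ra (trans e (swap-ac a b c))
    by-residues false false false _ _ _ (a , refl) (b , refl) (c , refl) e = again (rec n′<n n′≢0 a b c (sym S≡n′))
      where
      n′ = ∣ a ∣ ℕ.* ∣ a ∣ ℕ.+ ∣ b ∣ ℕ.* ∣ b ∣ ℕ.+ ∣ c ∣ ℕ.* ∣ c ∣
      S≡n′ : a * a + b * b + c * c ≡ + n′
      S≡n′ = sum-of-three-∣∣ a b c
      n≡9n′ : + n ≡ + 9 * + n′
      n≡9n′ = trans e (trans (sum-of-tripled-squares a b c) (cong (+ 9 *_) S≡n′))
      n≡ : n ≡ 9 ℕ.* n′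
      n≡ = ℤ.+-injective (trans n≡9n′ (sym (ℤ.pos-* 9 n′)))
      n′≢0 : n′ ≢ 0
      n′≢0 n′≡0 = n≢0 (trans n≡ (cong (9 ℕ.*_) n′≡0))
      n′<n : n′ ℕ.< n
      n′<n = subst (n′ ℕ.<_) (sym n≡) (ℕ.m<m+n n′ (ℕ.<-≤-trans (ℕ.n≢0⇒n>0 n′≢0) (ℕ.m≤n*m n′ 8)))
      again : Sum3 One₃ One₃ One₃ (+ 9 * + n′) → Sum3 One₃ One₃ One₃ (+ 9 * + n)
      again (sum3 {a} {b} {c} ra rb rc e) = rotate-three a b c ra rb rc (trans n≡9n′ e)

refine : ∀ {a b c} → Zero₃ a → Zero₃ b → Zero₃ c → a * a + b * b + c * c ≢ 0ℤ →
         Sum3 One₃ One₃ One₃ (a * a + b * b + c * c)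
refine (a , refl) (b , refl) (c , refl) ≢0 =
  subst (Sum3 One₃ One₃ One₃) (sym S≡)
    (nine-times n (λ n≡0 → ≢0 (trans S≡ (cong (λ n → + 9 * + n) n≡0))) a b c (sym (sum-of-three-∣∣ a b c)))
  where
  n = ∣ a ∣ ℕ.* ∣ a ∣ ℕ.+ ∣ b ∣ ℕ.* ∣ b ∣ ℕ.+ ∣ c ∣ ℕ.* ∣ c ∣
  S≡ : (+ 3 * a + 0ℤ) * (+ 3 * a + 0ℤ) + (+ 3 * b + 0ℤ) * (+ 3 * b + 0ℤ) +
       (+ 3 * c + 0ℤ) * (+ 3 * c + 0ℤ) ≡ + 9 * + n
  S≡ = trans (sum-of-tripled-squares a b c) (cong (+ 9 *_) (sum-of-three-∣∣ a b c))

split : ∀ a b c d → a * a + b * b + c * c + d * d ≡ a * a + (b * b + c * c + d * d)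
split = solve-∀

refine₂₃₄ : Sum4 (P ∩ SquareOtherThan m) Zero₃ Zero₃ Zero₃ m → Sum4 P One₃ One₃ One₃ m
refine₂₃₄ {m = m} (sum4 {a} {b} {c} {d} (pa , a²≢m) zb zc zd eq)
  with refine zb zc zd (λ S≡0 → a²≢m (sym (trans eq (trans (split a b c d)
         (trans (cong (λ s → a * a + s) S≡0) (ℤ.+-identityʳ (a * a)))))))
... | sum3 {b′} {c′} {d′} ob oc od e =
  sum4 pa ob oc od (trans eq (trans (split a b c d) (trans (cong (λ s → a * a + s) e) (sym (split a b′ c′ d′)))))

⊑-refl : P ⊑ P
⊑-refl x p = x , p , refl

forget : ∀ m → (P ∩ SquareOtherThan m) ⊑ P
forget m x (p , _) = x , p , refl

data TwoOnes (m : ℤ) : Set where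
  four  : Sum4 One₃ One₃ One₃ One₃ m → TwoOnes m
  three : Sum4 One₃ One₃ One₃ Zero₃ m → TwoOnes m
  two   : Sum4 One₃ One₃ Zero₃ Zero₃ m → TwoOnes m

-- At most one coordinate prime to 3 leaves three multiples of 3 to rotate, which gives four or
-- three ones.
twoOnes : ∀ n → 2 ℕ.≤ n → TwoOnes (+ n)
twoOnes n 2≤n with sort₄ {C = C} (classify₄ cl cl cl cl (2≤n⇒ProperFourSquares n 2≤n))
  where
  C : Bool → Pred ℤ 0ℓ
  C b = Res 3 b ∩ SquareOtherThan (+ n)
  cl : Classifies C (SquareOtherThan (+ n))
  cl x ne with b , y , r , e ← mod3-up-to-sign x tt = b , y , (r , λ y²≡n → ne (trans (sym e) y²≡n)) , e
... | four r  = four (map4 (forget (+ n)) (forget (+ n)) (forget (+ n)) (forget (+ n)) r)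
... | three r = three (map4 (forget (+ n)) (forget (+ n)) (forget (+ n)) (forget (+ n)) r)
... | two r   = two (map4 (forget (+ n)) (forget (+ n)) (forget (+ n)) (forget (+ n)) r)
... | one r   = four (refine₂₃₄ (map4 ⊑-refl (forget (+ n)) (forget (+ n)) (forget (+ n)) r))
... | none r  = three (swap₃₄ (swap₂₃ (swap₁₂ (refine₂₃₄ (map4 ⊑-refl (forget (+ n)) (forget (+ n)) (forget (+ n)) r)))))

-- Generalized polygonal numbers

half-even : ∀ x t → x ≡ + 2 * t → + 2 * (x ℤ./ℕ 2) ≡ x
half-even x t x≡2t with x ℤ.%ℕ 2 | ℤ.n%ℕd<d x 2 | division x 2
... | 0 | _ | e = sym (trans e (ℤ.+-identityʳ _))
... | 1 | _ | e = contradiction (remainder-unique 2 (x ℤ./ℕ 2) t 1 0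
                    (trans (sym e) (trans x≡2t (sym (ℤ.+-identityʳ _))))) λ ()
... | suc (suc _) | ℕ.s≤s (ℕ.s≤s ()) | _

consecutive-even : ∀ x → ∃ λ t → x * x - x ≡ + 2 * t
consecutive-even x with parity x
... | false , k , refl = k * (+ 2 * k - 1ℤ) , identity k
  where
  identity : ∀ k → (+ 2 * k + 0ℤ) * (+ 2 * k + 0ℤ) - (+ 2 * k + 0ℤ) ≡ + 2 * (k * (+ 2 * k - 1ℤ))
  identity = solve-∀
... | true  , k , refl = k * (+ 2 * k + 1ℤ) , identity k
  where
  identity : ∀ k → (+ 2 * k + 1ℤ) * (+ 2 * k + 1ℤ) - (+ 2 * k + 1ℤ) ≡ + 2 * (k * (+ 2 * k + 1ℤ))
  identity = solve-∀

2*gonal : ∀ m x → + 2 * gonal m x ≡ (+ m - + 2) * x * x - (+ m - + 4) * x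
2*gonal m x with t , e ← consecutive-even x =
  -- The numerator is (m - 2)(x² - x) + 2x, and x² - x is even.
  half-even ((+ m - + 2) * x * x - (+ m - + 4) * x) ((+ m - + 2) * t + x) (from-difference (+ m - + 2) e (identity (+ m) x t))
  where
  identity : ∀ m x t → (m - + 2) * x * x - (m - + 4) * x - + 2 * ((m - + 2) * t + x) ≡
                       (m - + 2) * (x * x - x - + 2 * t)
  identity = solve-∀

-- Here `t` is a completed square, possibly scaled: `c` is the coefficient of the polygonal number
-- and `e` the constant that completing the square leaves behind.
data Attains (c m e : ℕ) (t : ℤ) : Set where
  attains : ∀ y → t ≡ + c * gonal m y + + e → Attains c m e t

gonal₃-square : ∀ x → (+ 2 * x + 1ℤ) * (+ 2 * x + 1ℤ) ≡ + 8 * gonal 3 x + 1ℤ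
gonal₃-square x = from-difference (- + 4) (2*gonal 3 x) (identity x (gonal 3 x))
  where
  identity : ∀ x g → (+ 2 * x + 1ℤ) * (+ 2 * x + 1ℤ) - (+ 8 * g + 1ℤ) ≡
                     - + 4 * (+ 2 * g - ((+ 3 - + 2) * x * x - (+ 3 - + 4) * x))
  identity = solve-∀

gonal₄-square : ∀ x → x * x ≡ gonal 4 x
gonal₄-square x = ℤ.*-cancelˡ-≡ (+ 2) (x * x) (gonal 4 x) (trans (identity x) (sym (2*gonal 4 x)))
  where
  identity : ∀ x → + 2 * (x * x) ≡ (+ 4 - + 2) * x * x - (+ 4 - + 4) * x
  identity = solve-∀

gonal₅-square : ∀ x → (+ 6 * x - 1ℤ) * (+ 6 * x - 1ℤ) ≡ + 24 * gonal 5 x + 1ℤ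
gonal₅-square x = from-difference (- + 12) (2*gonal 5 x) (identity x (gonal 5 x))
  where
  identity : ∀ x g → (+ 6 * x - 1ℤ) * (+ 6 * x - 1ℤ) - (+ 24 * g + 1ℤ) ≡
                     - + 12 * (+ 2 * g - ((+ 5 - + 2) * x * x - (+ 5 - + 4) * x))
  identity = solve-∀

gonal₈-square : ∀ x → (+ 3 * x - 1ℤ) * (+ 3 * x - 1ℤ) ≡ + 3 * gonal 8 x + 1ℤ
gonal₈-square x = ℤ.*-cancelˡ-≡ (+ 2) _ _ (from-difference (- + 3) (2*gonal 8 x) (identity x (gonal 8 x)))
  where
  identity : ∀ x g → + 2 * ((+ 3 * x - 1ℤ) * (+ 3 * x - 1ℤ)) - + 2 * (+ 3 * g + 1ℤ) ≡
                     - + 3 * (+ 2 * g - ((+ 8 - + 2) * x * x - (+ 8 - + 4) * x))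
  identity = solve-∀

-- With a coefficient of at least 2, g ≤ -1 would make s² negative; coefficient 1 would allow g = -1
-- and s = 0. The coefficients 8, 24 and 3 are passed below as 6, 22 and 1.
square-form-nonNegative : ∀ c g s → s * s ≡ + suc (suc c) * g + 1ℤ → ∃ λ k → g ≡ + k
square-form-nonNegative c (+ k) s _ = k , refl
square-form-nonNegative c -[1+ k ] s e = contradiction 1≡ (ℕ.<⇒≢ (ℕ.≤-trans big (ℕ.m≤n+m _ (∣ s ∣ ℕ.* ∣ s ∣))))
  where
  move : ∀ n c k → n ≡ c * - k + 1ℤ → 1ℤ ≡ n + c * k
  move n c k e = from-difference (- 1ℤ) e (solve (n ∷ c ∷ k ∷ []))
  1≡ : 1 ≡ ∣ s ∣ ℕ.* ∣ s ∣ ℕ.+ suc (suc c) ℕ.* suc k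
  1≡ = ℤ.+-injective (trans (move (+ (∣ s ∣ ℕ.* ∣ s ∣)) (+ suc (suc c)) (+ suc k) (trans (sym (square-∣∣ s)) e))
    (cong (λ z → + (∣ s ∣ ℕ.* ∣ s ∣) + z) (sym (ℤ.pos-* (suc (suc c)) (suc k)))))
  big : 2 ℕ.≤ suc (suc c) ℕ.* suc k
  big = ℕ.≤-trans (ℕ.s≤s (ℕ.s≤s ℕ.z≤n)) (ℕ.m≤m*n (suc (suc c)) (suc k))

gonal₃-nonNegative : ∀ x → ∃ λ k → gonal 3 x ≡ + k
gonal₃-nonNegative x = square-form-nonNegative 6 (gonal 3 x) (+ 2 * x + 1ℤ) (gonal₃-square x)

gonal₄-nonNegative : ∀ x → ∃ λ k → gonal 4 x ≡ + k
gonal₄-nonNegative x = ∣ x ∣ ℕ.* ∣ x ∣ , trans (sym (gonal₄-square x)) (square-∣∣ x)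

gonal₅-nonNegative : ∀ x → ∃ λ k → gonal 5 x ≡ + k
gonal₅-nonNegative x = square-form-nonNegative 22 (gonal 5 x) (+ 6 * x - 1ℤ) (gonal₅-square x)

gonal₈-nonNegative : ∀ x → ∃ λ k → gonal 8 x ≡ + k
gonal₈-nonNegative x = square-form-nonNegative 1 (gonal 8 x) (+ 3 * x - 1ℤ) (gonal₈-square x)

data Side : ℕ → Set where
  p₃ : Side 3
  p₄ : Side 4
  p₅ : Side 5
  p₈ : Side 8

gonal-nonNegative : ∀ {m} → Side m → ∀ x → ∃ λ k → gonal m x ≡ + k
gonal-nonNegative p₃ = gonal₃-nonNegative
gonal-nonNegative p₄ = gonal₄-nonNegative
gonal-nonNegative p₅ = gonal₅-nonNegative
gonal-nonNegative p₈ = gonal₈-nonNegative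

quaternary-nonNegative : ∀ a b c d {r s t u} → Side r → Side s → Side t → Side u →
  ∀ h l m n → ∃ λ k → quaternary a r b s c t d u h l m n ≡ + k
quaternary-nonNegative a b c d pr ps pt pu h l m n
  with h′ , eh ← gonal-nonNegative pr h | l′ , el ← gonal-nonNegative ps l
     | m′ , em ← gonal-nonNegative pt m | n′ , en ← gonal-nonNegative pu n =
  a ℕ.* h′ ℕ.+ b ℕ.* l′ ℕ.+ c ℕ.* m′ ℕ.+ d ℕ.* n′ ,
  cong₂ _+_ (cong₂ _+_ (cong₂ _+_ (term a eh) (term b el)) (term c em)) (term d en)
  where
  term : ∀ a {g k} → g ≡ + k → + a * g ≡ + (a ℕ.* k)
  term a {k = k} refl = sym (ℤ.pos-* a k)

data Represents (a r b s c t d u n : ℕ) : Set where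
  represents : ∀ h l m o → quaternary a r b s c t d u h l m o ≡ + n → Represents a r b s c t d u n

universal : ∀ {a r b s c t d u} → Side r → Side s → Side t → Side u →
            (∀ n → Represents a r b s c t d u n) → Universal a r b s c t d u
universal {a} {r} {b} {s} {c} {t} {d} {u} pr ps pt pu rep =
  quaternary-nonNegative a b c d pr ps pt pu , λ n → unpack (rep n)
  where
  unpack : ∀ {n} → Represents a r b s c t d u n →
           ∃ λ h → ∃ λ l → ∃ λ m → ∃ λ o → quaternary a r b s c t d u h l m o ≡ + n
  unpack (represents h l m o e) = h , l , m , o , e

attains-scale : ∀ k {c m e t} → Attains c m e t → Attains (k ℕ.* c) m (k ℕ.* e) (+ k * t)
attains-scale k {c} {m} {e} (attains y refl) = attains y (trans (identity (+ k) (+ c) (gonal m y) (+ e))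
  (cong₂ (λ a b → a * gonal m y + b) (sym (ℤ.pos-* k c)) (sym (ℤ.pos-* k e))))
  where
  identity : ∀ k c g e → k * (c * g + e) ≡ k * c * g + k * e
  identity = solve-∀

-- This fixes the progression for each sum: multiplied by C, the equation for n becomes one for C n
-- plus the constants left by the four completed squares. For 2p₅ + 2p₅ + p₈ + p₈ and C = 12 it is
-- 12n + (1 + 1 + 4 + 4).
attains⇒represents : ∀ C .{{_ : ℕ.NonZero C}} a b c d {r s t u} e₁ e₂ e₃ e₄ n {x y z w} →
  Attains (C ℕ.* a) r e₁ x → Attains (C ℕ.* b) s e₂ y → Attains (C ℕ.* c) t e₃ z → Attains (C ℕ.* d) u e₄ w →
  + C * + n + + (e₁ ℕ.+ e₂ ℕ.+ e₃ ℕ.+ e₄) ≡ x + y + z + w →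
  Represents a r b s c t d u n
attains⇒represents C a b c d {r} {s} {t} {u} e₁ e₂ e₃ e₄ n (attains h x≡) (attains l y≡) (attains m z≡) (attains o w≡) eq =
  represents h l m o (ℤ.*-cancelˡ-≡ (+ C) (quaternary a r b s c t d u h l m o) (+ n) (from-difference (- 1ℤ)
    (trans eq (cong₂ _+_ (cong₂ _+_ (cong₂ _+_ (term a x≡) (term b y≡)) (term c z≡)) (term d w≡)))
    (identity (+ C) (+ a) (+ b) (+ c) (+ d) (gonal r h) (gonal s l) (gonal t m) (gonal u o) (+ n) (+ e₁) (+ e₂) (+ e₃) (+ e₄))))
  where
  term : ∀ a {x g e} → x ≡ + (C ℕ.* a) * g + e → x ≡ + C * + a * g + e
  term a {g = g} {e} x≡ = trans x≡ (cong (λ k → k * g + e) (ℤ.pos-* C a))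
  identity : ∀ C a b c d g₁ g₂ g₃ g₄ n e₁ e₂ e₃ e₄ →
    C * (a * g₁ + b * g₂ + c * g₃ + d * g₄) - C * n ≡
    - 1ℤ * (C * n + (e₁ + e₂ + e₃ + e₄) -
      (C * a * g₁ + e₁ + (C * b * g₂ + e₂) + (C * c * g₃ + e₃) + (C * d * g₄ + e₄)))
  identity = solve-∀

attains-odd : ∀ x → Odd x → Attains 8 3 1 (x * x)
attains-odd _ (k , refl) = attains k (gonal₃-square k)

attains-zero₃ : ∀ x → Zero₃ x → Attains 9 4 0 (x * x)
attains-zero₃ _ (k , refl) = attains k (trans (identity k) (cong (λ g → + 9 * g + 0ℤ) (gonal₄-square k)))
  where
  identity : ∀ k → (+ 3 * k + 0ℤ) * (+ 3 * k + 0ℤ) ≡ + 9 * (k * k) + 0ℤ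
  identity = solve-∀

attains-one₃ : ∀ x → One₃ x → Attains 3 8 1 (x * x)
attains-one₃ _ (k , refl) = attains (- k) (trans (identity k) (gonal₈-square (- k)))
  where
  identity : ∀ k → (+ 3 * k + 1ℤ) * (+ 3 * k + 1ℤ) ≡ (+ 3 * - k - 1ℤ) * (+ 3 * - k - 1ℤ)
  identity = solve-∀

-- In the next four lemmas x is recovered from its residues mod 2 and mod 3 as 3x - 2x or 4x - 3x.
attains-odd-zero₃ : ∀ x → (Zero₃ ∩ Odd) x → Attains 72 3 9 (x * x)
attains-odd-zero₃ x ((l , x≡3l) , (k , x≡2k+1)) = attains (k - l)
  (trans (cong (λ x → x * x) x≡) (trans (square (+ 2 * (k - l) + 1ℤ))
    (trans (cong (+ 9 *_) (gonal₃-square (k - l))) (expand (gonal 3 (k - l))))))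
  where
  identity : ∀ x k l → x - + 3 * (+ 2 * (k - l) + 1ℤ) ≡ 1ℤ * (+ 3 * x + - + 2 * x - (+ 3 * (+ 2 * k + 1ℤ) + - + 2 * (+ 3 * l + 0ℤ)))
  identity = solve-∀
  x≡ : x ≡ + 3 * (+ 2 * (k - l) + 1ℤ)
  x≡ = from-difference 1ℤ (cong₂ (λ y z → + 3 * y + - + 2 * z) x≡2k+1 x≡3l) (identity x k l)
  square : ∀ y → + 3 * y * (+ 3 * y) ≡ + 9 * (y * y)
  square = solve-∀
  expand : ∀ g → + 9 * (+ 8 * g + 1ℤ) ≡ + 72 * g + + 9
  expand = solve-∀

attains-even-zero₃ : ∀ x → (Zero₃ ∩ Even) x → Attains 36 4 0 (x * x)
attains-even-zero₃ x ((l , x≡3l) , (k , x≡2k)) = attains (k - l)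
  (trans (cong (λ x → x * x) x≡) (trans (square (k - l)) (cong (λ g → + 36 * g + 0ℤ) (gonal₄-square (k - l)))))
  where
  identity : ∀ x k l → x - + 6 * (k - l) ≡ 1ℤ * (+ 3 * x + - + 2 * x - (+ 3 * (+ 2 * k + 0ℤ) + - + 2 * (+ 3 * l + 0ℤ)))
  identity = solve-∀
  x≡ : x ≡ + 6 * (k - l)
  x≡ = from-difference 1ℤ (cong₂ (λ y z → + 3 * y + - + 2 * z) x≡2k x≡3l) (identity x k l)
  square : ∀ y → + 6 * y * (+ 6 * y) ≡ + 36 * (y * y) + 0ℤ
  square = solve-∀

attains-odd-one₃ : ∀ x → (One₃ ∩ Odd) x → Attains 24 5 1 (x * x)
attains-odd-one₃ x ((l , x≡3l+1) , (k , x≡2k+1)) = attains (l - k)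
  (trans (cong (λ x → x * x) x≡) (trans (neg² (+ 6 * (l - k) - 1ℤ)) (gonal₅-square (l - k))))
  where
  identity : ∀ x k l → x - - (+ 6 * (l - k) - 1ℤ) ≡ 1ℤ * (+ 3 * x + - + 2 * x - (+ 3 * (+ 2 * k + 1ℤ) + - + 2 * (+ 3 * l + 1ℤ)))
  identity = solve-∀
  x≡ : x ≡ - (+ 6 * (l - k) - 1ℤ)
  x≡ = from-difference 1ℤ (cong₂ (λ y z → + 3 * y + - + 2 * z) x≡2k+1 x≡3l+1) (identity x k l)

attains-even-one₃ : ∀ x → (One₃ ∩ Even) x → Attains 12 8 4 (x * x)
attains-even-one₃ x ((l , x≡3l+1) , (k , x≡2k)) = attains y
  (trans (cong (λ x → x * x) x≡) (trans (square (+ 3 * y - 1ℤ))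
    (trans (cong (+ 4 *_) (gonal₈-square y)) (expand (gonal 8 y)))))
  where
  y = + 2 * l + 1ℤ - k
  identity : ∀ x k l → x - + 2 * (+ 3 * (+ 2 * l + 1ℤ - k) - 1ℤ) ≡ 1ℤ * (- + 3 * x + + 4 * x - (- + 3 * (+ 2 * k + 0ℤ) + + 4 * (+ 3 * l + 1ℤ)))
  identity = solve-∀
  x≡ : x ≡ + 2 * (+ 3 * y - 1ℤ)
  x≡ = from-difference 1ℤ (cong₂ (λ y z → - + 3 * y + + 4 * z) x≡2k x≡3l+1) (identity x k l)
  square : ∀ y → + 2 * y * (+ 2 * y) ≡ + 4 * (y * y)
  square = solve-∀
  expand : ∀ g → + 4 * (+ 3 * g + 1ℤ) ≡ + 12 * g + + 4
  expand = solve-∀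

-- The sixteen sums

residue-in-progression : ∀ c .{{_ : ℕ.NonZero c}} {i j k l} d r n →
  P ⊆ SqRes c i → Q ⊆ SqRes c j → S ⊆ SqRes c k → T ⊆ SqRes c l →
  Sum4 P Q S T (+ (c ℕ.* d) * + n + + r) →
  (bit i ℕ.+ bit j ℕ.+ bit k ℕ.+ bit l) ℕ.% c ≡ r ℕ.% c
residue-in-progression c d r n f g h e s =
  residue₄ c (+ d * + n) r f g h e (subst (Sum4 _ _ _ _)
    (cong (_+ + r) (trans (cong (_* + n) (ℤ.pos-* c d)) (ℤ.*-assoc (+ c) (+ d) (+ n)))) s)

twoOnes-in-progression : ∀ c r n → 2 ℕ.≤ r → TwoOnes (+ c * + n + + r)
twoOnes-in-progression c r n 2≤r =
  subst TwoOnes (cong (_+ + r) (ℤ.pos-* c n)) (twoOnes (c ℕ.* n ℕ.+ r) (ℕ.≤-trans 2≤r (ℕ.m≤n+m r (c ℕ.* n))))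

-- Of the possible counts 2, 3, 4 of coordinates prime to 3, only 4 is 1 modulo 3; in `two-ones`,
-- only 2 is 2 modulo 3.
four-ones : ∀ d r n → 2 ℕ.≤ r → r ℕ.% 3 ≡ 1 → Sum4 One₃ One₃ One₃ One₃ (+ (3 ℕ.* d) * + n + + r)
four-ones d r n 2≤r r≡1 with twoOnes-in-progression (3 ℕ.* d) r n 2≤r
... | four s  = s
... | three s with () ← trans (residue-in-progression 3 d r n (Res⇒SqRes 3) (Res⇒SqRes 3) (Res⇒SqRes 3) (Res⇒SqRes 3) s) r≡1
... | two s   with () ← trans (residue-in-progression 3 d r n (Res⇒SqRes 3) (Res⇒SqRes 3) (Res⇒SqRes 3) (Res⇒SqRes 3) s) r≡1

two-ones : ∀ d r n → 2 ℕ.≤ r → r ℕ.% 3 ≡ 2 → Sum4 One₃ One₃ Zero₃ Zero₃ (+ (3 ℕ.* d) * + n + + r)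
two-ones d r n 2≤r r≡2 with twoOnes-in-progression (3 ℕ.* d) r n 2≤r
... | two s   = s
... | three s with () ← trans (residue-in-progression 3 d r n (Res⇒SqRes 3) (Res⇒SqRes 3) (Res⇒SqRes 3) (Res⇒SqRes 3) s) r≡2
... | four s  with () ← trans (residue-in-progression 3 d r n (Res⇒SqRes 3) (Res⇒SqRes 3) (Res⇒SqRes 3) (Res⇒SqRes 3) s) r≡2

∩Res⇒SqRes₄ : ∀ {b} → (P ∩ Res 2 b) ⊆ SqRes 4 b
∩Res⇒SqRes₄ {b = b} (_ , r) = Res₂⇒SqRes₄ {b} r

-- Odd squares are 1 and even squares 0 modulo 4, so `r` modulo 4 fixes the number of odd
-- coordinates, except that 0 and 4 are not told apart.
parity-count : ∀ {i j k l} d r n →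
  Sum4 (P ∩ Res 2 i) (Q ∩ Res 2 j) (S ∩ Res 2 k) (T ∩ Res 2 l) (+ (4 ℕ.* d) * + n + + r) →
  (bit i ℕ.+ bit j ℕ.+ bit k ℕ.+ bit l) ℕ.% 4 ≡ r ℕ.% 4
parity-count {P} {Q} {S} {T} {i} {j} {k} {l} d r n =
  residue-in-progression 4 {i} {j} {k} {l} d r n
    (∩Res⇒SqRes₄ {P} {i}) (∩Res⇒SqRes₄ {Q} {j}) (∩Res⇒SqRes₄ {S} {k}) (∩Res⇒SqRes₄ {T} {l})

sort-parities : Sum4 P P P P m → Sorted₄ (λ b → P ∩ Res 2 b) m
sort-parities s = sort₄ (parities s)

three-odd : ∀ d r n → r ℕ.% 4 ≡ 3 → Sum4 P P P P (+ (4 ℕ.* d) * + n + + r) →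
            Sum4 (P ∩ Odd) (P ∩ Odd) (P ∩ Odd) (P ∩ Even) (+ (4 ℕ.* d) * + n + + r)
three-odd d r n r≡3 s with sort-parities s
... | three s = s
... | four s with () ← trans (parity-count d r n s) r≡3
... | two s  with () ← trans (parity-count d r n s) r≡3
... | one s  with () ← trans (parity-count d r n s) r≡3
... | none s with () ← trans (parity-count d r n s) r≡3

two-odd : ∀ d r n → r ℕ.% 4 ≡ 2 → Sum4 P P P P (+ (4 ℕ.* d) * + n + + r) →
          Sum4 (P ∩ Odd) (P ∩ Odd) (P ∩ Even) (P ∩ Even) (+ (4 ℕ.* d) * + n + + r)
two-odd d r n r≡2 s with sort-parities s
... | two s   = s
... | four s  with () ← trans (parity-count d r n s) r≡2
... | three s with () ← trans (parity-count d r n s) r≡2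
... | one s   with () ← trans (parity-count d r n s) r≡2
... | none s  with () ← trans (parity-count d r n s) r≡2

one-odd : ∀ d r n → r ℕ.% 4 ≡ 1 → Sum4 P P P P (+ (4 ℕ.* d) * + n + + r) →
          Sum4 (P ∩ Odd) (P ∩ Even) (P ∩ Even) (P ∩ Even) (+ (4 ℕ.* d) * + n + + r)
one-odd d r n r≡1 s with sort-parities s
... | one s   = s
... | four s  with () ← trans (parity-count d r n s) r≡1
... | three s with () ← trans (parity-count d r n s) r≡1
... | two s   with () ← trans (parity-count d r n s) r≡1
... | none s  with () ← trans (parity-count d r n s) r≡1

2≤ : ∀ {n} → 2 ℕ.≤ suc (suc n)
2≤ = ℕ.s≤s (ℕ.s≤s ℕ.z≤n)

universal-2p₅+2p₅+p₈+p₈ : Universal 2 5 2 5 1 8 1 8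
universal-2p₅+2p₅+p₈+p₈ = universal p₅ p₅ p₈ p₈ λ n → represent n (two-odd 3 10 n refl (four-ones 4 10 n 2≤ refl))
  where
  represent : ∀ n → Sum4 (One₃ ∩ Odd) (One₃ ∩ Odd) (One₃ ∩ Even) (One₃ ∩ Even) (+ 12 * + n + + 10) →
              Represents 2 5 2 5 1 8 1 8 n
  represent n (sum4 {a} {b} {c} {d} ra rb rc rd eq) = attains⇒represents 12 2 2 1 1 1 1 4 4 n
    (attains-odd-one₃ a ra) (attains-odd-one₃ b rb) (attains-even-one₃ c rc) (attains-even-one₃ d rd) eq

universal-p₈+p₈+p₈+p₈ : Universal 1 8 1 8 1 8 1 8
universal-p₈+p₈+p₈+p₈ = universal p₈ p₈ p₈ p₈ λ n → represent n (four-ones 1 4 n 2≤ refl)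
  where
  represent : ∀ n → Sum4 One₃ One₃ One₃ One₃ (+ 3 * + n + + 4) → Represents 1 8 1 8 1 8 1 8 n
  represent n (sum4 {a} {b} {c} {d} ra rb rc rd eq) = attains⇒represents 3 1 1 1 1 1 1 1 1 n
    (attains-one₃ a ra) (attains-one₃ b rb) (attains-one₃ c rc) (attains-one₃ d rd) eq

one₃-+-zero₃ : ∀ {x y} → One₃ x → Zero₃ y → One₃ (x + y)
one₃-+-zero₃ (k , refl) (l , refl) = k + l , identity k l
  where
  identity : ∀ k l → + 3 * k + 1ℤ + (+ 3 * l + 0ℤ) ≡ + 3 * (k + l) + 1ℤ
  identity = solve-∀

one₃-−-zero₃ : ∀ {x y} → One₃ x → Zero₃ y → One₃ (x - y)
one₃-−-zero₃ (k , refl) (l , refl) = k - l , identity k l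
  where
  identity : ∀ k l → + 3 * k + 1ℤ - (+ 3 * l + 0ℤ) ≡ + 3 * (k - l) + 1ℤ
  identity = solve-∀

one₃-+-one₃ : ∀ {x y} → One₃ x → One₃ y → One₃ (- (x + y))
one₃-+-one₃ (k , refl) (l , refl) = - k - l - 1ℤ , identity k l
  where
  identity : ∀ k l → - (+ 3 * k + 1ℤ + (+ 3 * l + 1ℤ)) ≡ + 3 * (- k - l - 1ℤ) + 1ℤ
  identity = solve-∀

one₃-−-one₃ : ∀ {x y} → One₃ x → One₃ y → Zero₃ (x - y)
one₃-−-one₃ (k , refl) (l , refl) = k - l , identity k l
  where
  identity : ∀ k l → + 3 * k + 1ℤ - (+ 3 * l + 1ℤ) ≡ + 3 * (k - l) + 0ℤ
  identity = solve-∀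

odd-+-even : ∀ i {x y} → Res 2 i x → Res 2 (not i) y → Odd (x + y)
odd-+-even false (k , refl) (l , refl) = k + l , identity k l
  where
  identity : ∀ k l → + 2 * k + 0ℤ + (+ 2 * l + 1ℤ) ≡ + 2 * (k + l) + 1ℤ
  identity = solve-∀
odd-+-even true (k , refl) (l , refl) = k + l , identity k l
  where
  identity : ∀ k l → + 2 * k + 1ℤ + (+ 2 * l + 0ℤ) ≡ + 2 * (k + l) + 1ℤ
  identity = solve-∀

same-parity-+ : ∀ i {x y} → Res 2 i x → Res 2 i y → Even (x + y)
same-parity-+ i (k , refl) (l , refl) = k + l + + bit i , identity k l (+ bit i)
  where
  identity : ∀ k l i → + 2 * k + i + (+ 2 * l + i) ≡ + 2 * (k + l + i) + 0ℤ
  identity = solve-∀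

neg-parity : ∀ i {x} → Res 2 i x → Res 2 i (- x)
neg-parity i (k , refl) = - k - + bit i , identity k (+ bit i)
  where
  identity : ∀ k i → - (+ 2 * k + i) ≡ + 2 * (- k - i) + i
  identity = solve-∀

odd-−-even : ∀ i {x y} → Res 2 i x → Res 2 (not i) y → Odd (x - y)
odd-−-even i rx ry = odd-+-even i rx (neg-parity (not i) ry)

same-parity-− : ∀ i {x y} → Res 2 i x → Res 2 i y → Even (x - y)
same-parity-− i rx ry = same-parity-+ i rx (neg-parity i ry)

universal-3p₄+3p₄+p₈+p₈ : Universal 3 4 3 4 1 8 1 8
universal-3p₄+3p₄+p₈+p₈ = universal p₄ p₄ p₈ p₈ λ n → represent n (two-ones 1 2 n 2≤ refl)
  where
  represent : ∀ n → Sum4 One₃ One₃ Zero₃ Zero₃ (+ 3 * + n + + 2) → Represents 3 4 3 4 1 8 1 8 n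
  represent n (sum4 {a} {b} {c} {d} ra rb rc rd eq) = attains⇒represents 3 3 3 1 1 0 0 1 1 n
    (attains-zero₃ c rc) (attains-zero₃ d rd) (attains-one₃ a ra) (attains-one₃ b rb)
    (trans eq (reorder a b c d))
    where
    reorder : ∀ a b c d → a * a + b * b + c * c + d * d ≡ c * c + d * d + a * a + b * b
    reorder = solve-∀

-- The constants add up to 9 + 0 + 1 + 4 = 14, and 12n + 14 = 2(6n + 7). For x ≡ y ≡ 1 modulo 3,
-- 2(x² + y²) = (x - y)² + (x + y)² has one base divisible by 3 and one prime to 3, as p₃ or p₄ and
-- p₅ or p₈ require here.
universal-6p₃+3p₄+2p₅+p₈ : Universal 6 3 3 4 2 5 1 8
universal-6p₃+3p₄+2p₅+p₈ = universal p₃ p₄ p₅ p₈ λ n → represent n (pair-up n (four-ones 2 7 n 2≤ refl))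
  where
  Paired : ℕ → Set
  Paired n = ∃ λ j → Sum4 (One₃ ∩ Odd) (One₃ ∩ Even) (One₃ ∩ Res 2 j) (One₃ ∩ Res 2 j) (+ 6 * + n + + 7)
  ∩Res⇒SqRes₂ : ∀ {b} → (One₃ ∩ Res 2 b) ⊆ SqRes 2 b
  ∩Res⇒SqRes₂ (_ , r) = Res⇒SqRes 2 r
  -- One or three odd coordinates: either way they split into a pair of opposite parity and a pair
  -- of equal parity.
  pair-up : ∀ n → Sum4 One₃ One₃ One₃ One₃ (+ 6 * + n + + 7) → Paired n
  pair-up n s with sort-parities s
  ... | three s = true , swap₂₃ (swap₃₄ s)
  ... | one s   = false , s
  ... | four s with () ← residue-in-progression 2 {true} {true} {true} {true} 3 7 n ∩Res⇒SqRes₂ ∩Res⇒SqRes₂ ∩Res⇒SqRes₂ ∩Res⇒SqRes₂ s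
  ... | two s  with () ← residue-in-progression 2 {true} {true} {false} {false} 3 7 n ∩Res⇒SqRes₂ ∩Res⇒SqRes₂ ∩Res⇒SqRes₂ ∩Res⇒SqRes₂ s
  ... | none s with () ← residue-in-progression 2 {false} {false} {false} {false} 3 7 n ∩Res⇒SqRes₂ ∩Res⇒SqRes₂ ∩Res⇒SqRes₂ ∩Res⇒SqRes₂ s
  represent : ∀ n → Paired n → Represents 6 3 3 4 2 5 1 8 n
  represent n (j , sum4 {a} {b} {c} {d} (a₃ , a₂) (b₃ , b₂) (c₃ , c₂) (d₃ , d₂) eq) =
    attains⇒represents 12 6 3 2 1 9 0 1 4 n
      (attains-odd-zero₃ (a - b) (one₃-−-one₃ a₃ b₃ , odd-−-even true a₂ b₂))
      (attains-even-zero₃ (c - d) (one₃-−-one₃ c₃ d₃ , same-parity-− j c₂ d₂))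
      (attains-odd-one₃ (- (a + b)) (one₃-+-one₃ a₃ b₃ , neg-parity true (odd-+-even true a₂ b₂)))
      (attains-even-one₃ (- (c + d)) (one₃-+-one₃ c₃ d₃ , neg-parity false (same-parity-+ j c₂ d₂)))
      (from-difference (+ 2) eq (identity (+ n) a b c d))
    where
    identity : ∀ n a b c d → + 12 * n + + 14 -
      ((a - b) * (a - b) + (c - d) * (c - d) + - (a + b) * - (a + b) + - (c + d) * - (c + d)) ≡
      + 2 * (+ 6 * n + + 7 - (a * a + b * b + c * c + d * d))
    identity = solve-∀

universal-3p₃+p₅+2p₅+2p₅ : Universal 3 3 1 5 2 5 2 5
universal-3p₃+p₅+2p₅+2p₅ = universal p₃ p₅ p₅ p₅ λ n → represent n (three-odd 3 7 n refl (four-ones 4 7 n 2≤ refl))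
  where
  represent : ∀ n → Sum4 (One₃ ∩ Odd) (One₃ ∩ Odd) (One₃ ∩ Odd) (One₃ ∩ Even) (+ 12 * + n + + 7) →
              Represents 3 3 1 5 2 5 2 5 n
  represent n (sum4 {a} {b} {c} {d} (a₃ , a₂) rb rc (d₃ , d₂) eq) =
    attains⇒represents 24 3 1 2 2 9 1 2 2 n
      (attains-odd-zero₃ (a - d) (one₃-−-one₃ a₃ d₃ , odd-−-even true a₂ d₂))
      (attains-odd-one₃ (- (a + d)) (one₃-+-one₃ a₃ d₃ , neg-parity true (odd-+-even true a₂ d₂)))
      (attains-scale 2 (attains-odd-one₃ b rb)) (attains-scale 2 (attains-odd-one₃ c rc))
      (from-difference (+ 2) eq (identity (+ n) a b c d))
    where
    identity : ∀ n a b c d → + 24 * n + + 14 -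
      ((a - d) * (a - d) + - (a + d) * - (a + d) + + 2 * (b * b) + + 2 * (c * c)) ≡
      + 2 * (+ 12 * n + + 7 - (a * a + b * b + c * c + d * d))
    identity = solve-∀

universal-3p₃+p₅+p₈+p₈ : Universal 3 3 1 5 1 8 1 8
universal-3p₃+p₅+p₈+p₈ = universal p₃ p₅ p₈ p₈ λ n → represent n (one-odd 3 13 n refl (four-ones 4 13 n 2≤ refl))
  where
  represent : ∀ n → Sum4 (One₃ ∩ Odd) (One₃ ∩ Even) (One₃ ∩ Even) (One₃ ∩ Even) (+ 12 * + n + + 13) →
              Represents 3 3 1 5 1 8 1 8 n
  represent n (sum4 {a} {b} {c} {d} (a₃ , a₂) rb rc (d₃ , d₂) eq) =
    attains⇒represents 24 3 1 1 1 9 1 8 8 n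
      (attains-odd-zero₃ (a - d) (one₃-−-one₃ a₃ d₃ , odd-−-even true a₂ d₂))
      (attains-odd-one₃ (- (a + d)) (one₃-+-one₃ a₃ d₃ , neg-parity true (odd-+-even true a₂ d₂)))
      (attains-scale 2 (attains-even-one₃ b rb)) (attains-scale 2 (attains-even-one₃ c rc))
      (from-difference (+ 2) eq (identity (+ n) a b c d))
    where
    identity : ∀ n a b c d → + 24 * n + + 26 -
      ((a - d) * (a - d) + - (a + d) * - (a + d) + + 2 * (b * b) + + 2 * (c * c)) ≡
      + 2 * (+ 12 * n + + 13 - (a * a + b * b + c * c + d * d))
    identity = solve-∀

universal-3p₄+p₅+p₅+p₈ : Universal 3 4 1 5 1 5 1 8
universal-3p₄+p₅+p₅+p₈ = universal p₄ p₅ p₅ p₈ λ n → represent n (pair-up n (two-ones 4 5 n 2≤ refl))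
  where
  Paired : ℕ → Set
  Paired n = ∃ λ i → Sum4 (One₃ ∩ Res 2 i) (Zero₃ ∩ Res 2 (not i)) (One₃ ∩ Even) (Zero₃ ∩ Even) (+ 12 * + n + + 5)
  -- The single odd coordinate is paired with one of the other class modulo 3, so that sum and
  -- difference are both odd and prime to 3.
  pair-up : ∀ n → Sum4 One₃ One₃ Zero₃ Zero₃ (+ 12 * + n + + 5) → Paired n
  pair-up n s with parities s
  ... | true  , false , false , false , s = true , swap₂₃ s
  ... | false , true  , false , false , s = true , swap₂₃ (swap₁₂ s)
  ... | false , false , true  , false , s = false , swap₂₃ s
  ... | false , false , false , true  , s = false , swap₂₃ (swap₃₄ s)
  ... | true  , true  , false , false , s with () ← parity-count 3 5 n s
  ... | true  , false , true  , false , s with () ← parity-count 3 5 n s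
  ... | true  , false , false , true  , s with () ← parity-count 3 5 n s
  ... | false , true  , true  , false , s with () ← parity-count 3 5 n s
  ... | false , true  , false , true  , s with () ← parity-count 3 5 n s
  ... | false , false , true  , true  , s with () ← parity-count 3 5 n s
  ... | true  , true  , true  , false , s with () ← parity-count 3 5 n s
  ... | true  , true  , false , true  , s with () ← parity-count 3 5 n s
  ... | true  , false , true  , true  , s with () ← parity-count 3 5 n s
  ... | false , true  , true  , true  , s with () ← parity-count 3 5 n s
  ... | true  , true  , true  , true  , s with () ← parity-count 3 5 n s
  ... | false , false , false , false , s with () ← parity-count 3 5 n s
  represent : ∀ n → Paired n → Represents 3 4 1 5 1 5 1 8 n
  represent n (i , sum4 {a} {b} {c} {d} (a₃ , a₂) (b₃ , b₂) rc rd eq) =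
    attains⇒represents 24 3 1 1 1 0 1 1 8 n
      (attains-scale 2 (attains-even-zero₃ d rd))
      (attains-odd-one₃ (a + b) (one₃-+-zero₃ a₃ b₃ , odd-+-even i a₂ b₂))
      (attains-odd-one₃ (a - b) (one₃-−-zero₃ a₃ b₃ , odd-−-even i a₂ b₂))
      (attains-scale 2 (attains-even-one₃ c rc))
      (from-difference (+ 2) eq (identity (+ n) a b c d))
    where
    identity : ∀ n a b c d → + 24 * n + + 10 -
      (+ 2 * (d * d) + (a + b) * (a + b) + (a - b) * (a - b) + + 2 * (c * c)) ≡
      + 2 * (+ 12 * n + + 5 - (a * a + b * b + c * c + d * d))
    identity = solve-∀

universal-6p₃+p₅+p₅+2p₅ : Universal 6 3 1 5 1 5 2 5
universal-6p₃+p₅+p₅+2p₅ = universal p₃ p₅ p₅ p₅ λ n → represent n (pair-up n (two-ones 4 11 n 2≤ refl))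
  where
  Paired : ℕ → Set
  Paired n = ∃ λ i → Sum4 (One₃ ∩ Res 2 i) (Zero₃ ∩ Res 2 (not i)) (One₃ ∩ Odd) (Zero₃ ∩ Odd) (+ 12 * + n + + 11)
  -- Now the single even coordinate is the one paired with a coordinate of the other class modulo 3.
  pair-up : ∀ n → Sum4 One₃ One₃ Zero₃ Zero₃ (+ 12 * + n + + 11) → Paired n
  pair-up n s with parities s
  ... | true  , true  , true  , false , s = true , swap₂₃ (swap₃₄ s)
  ... | true  , true  , false , true  , s = true , swap₂₃ s
  ... | true  , false , true  , true  , s = false , swap₂₃ (swap₁₂ s)
  ... | false , true  , true  , true  , s = false , swap₂₃ s
  ... | true  , false , false , false , s with () ← parity-count 3 11 n s
  ... | false , true  , false , false , s with () ← parity-count 3 11 n s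
  ... | false , false , true  , false , s with () ← parity-count 3 11 n s
  ... | false , false , false , true  , s with () ← parity-count 3 11 n s
  ... | true  , true  , false , false , s with () ← parity-count 3 11 n s
  ... | true  , false , true  , false , s with () ← parity-count 3 11 n s
  ... | true  , false , false , true  , s with () ← parity-count 3 11 n s
  ... | false , true  , true  , false , s with () ← parity-count 3 11 n s
  ... | false , true  , false , true  , s with () ← parity-count 3 11 n s
  ... | false , false , true  , true  , s with () ← parity-count 3 11 n s
  ... | true  , true  , true  , true  , s with () ← parity-count 3 11 n s
  ... | false , false , false , false , s with () ← parity-count 3 11 n s
  represent : ∀ n → Paired n → Represents 6 3 1 5 1 5 2 5 n
  represent n (i , sum4 {a} {b} {c} {d} (a₃ , a₂) (b₃ , b₂) rc rd eq) =
    attains⇒represents 24 6 1 1 2 18 1 1 2 n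
      (attains-scale 2 (attains-odd-zero₃ d rd))
      (attains-odd-one₃ (a + b) (one₃-+-zero₃ a₃ b₃ , odd-+-even i a₂ b₂))
      (attains-odd-one₃ (a - b) (one₃-−-zero₃ a₃ b₃ , odd-−-even i a₂ b₂))
      (attains-scale 2 (attains-odd-one₃ c rc))
      (from-difference (+ 2) eq (identity (+ n) a b c d))
    where
    identity : ∀ n a b c d → + 24 * n + + 22 -
      (+ 2 * (d * d) + (a + b) * (a + b) + (a - b) * (a - b) + + 2 * (c * c)) ≡
      + 2 * (+ 12 * n + + 11 - (a * a + b * b + c * c + d * d))
    identity = solve-∀

universal-2p₅+2p₅+2p₅+p₈ : Universal 2 5 2 5 2 5 1 8
universal-2p₅+2p₅+2p₅+p₈ = universal p₅ p₅ p₅ p₈ λ n → represent n (three-odd 3 7 n refl (four-ones 4 7 n 2≤ refl))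
  where
  represent : ∀ n → Sum4 (One₃ ∩ Odd) (One₃ ∩ Odd) (One₃ ∩ Odd) (One₃ ∩ Even) (+ 12 * + n + + 7) →
              Represents 2 5 2 5 2 5 1 8 n
  represent n (sum4 {a} {b} {c} {d} ra rb rc rd eq) = attains⇒represents 12 2 2 2 1 1 1 1 4 n
    (attains-odd-one₃ a ra) (attains-odd-one₃ b rb) (attains-odd-one₃ c rc) (attains-even-one₃ d rd) eq

universal-2p₅+p₈+p₈+p₈ : Universal 2 5 1 8 1 8 1 8
universal-2p₅+p₈+p₈+p₈ = universal p₅ p₈ p₈ p₈ λ n → represent n (one-odd 3 13 n refl (four-ones 4 13 n 2≤ refl))
  where
  represent : ∀ n → Sum4 (One₃ ∩ Odd) (One₃ ∩ Even) (One₃ ∩ Even) (One₃ ∩ Even) (+ 12 * + n + + 13) →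
              Represents 2 5 1 8 1 8 1 8 n
  represent n (sum4 {a} {b} {c} {d} ra rb rc rd eq) = attains⇒represents 12 2 1 1 1 1 4 4 4 n
    (attains-odd-one₃ a ra) (attains-even-one₃ b rb) (attains-even-one₃ c rc) (attains-even-one₃ d rd) eq

-- Sums decided modulo 8

attains-odd-nonZero₃ : ∀ x → NonZero₃ x → Odd x → Attains 24 5 1 (x * x)
attains-odd-nonZero₃ x (inj₁ r) odd = attains-odd-one₃ x (r , odd)
attains-odd-nonZero₃ x (inj₂ r) odd =
  subst (Attains 24 5 1) (neg² x) (attains-odd-one₃ (- x) (r , neg-parity true odd))

attains-even-nonZero₃ : ∀ x → NonZero₃ x → Even x → Attains 12 8 4 (x * x)
attains-even-nonZero₃ x (inj₁ r) even = attains-even-one₃ x (r , even)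
attains-even-nonZero₃ x (inj₂ r) even =
  subst (Attains 12 8 4) (neg² x) (attains-even-one₃ (- x) (r , neg-parity false even))

attains-square : ∀ x → Attains 1 4 0 (x * x)
attains-square x = attains x (trans (gonal₄-square x) (identity (gonal 4 x)))
  where
  identity : ∀ g → g ≡ + 1 * g + 0ℤ
  identity = solve-∀

attains-even : ∀ x → Even x → Attains 4 4 0 (x * x)
attains-even _ (k , refl) =
  subst (Attains 4 4 0) (identity k) (attains-scale 4 (attains-square k))
  where
  identity : ∀ k → + 4 * (k * k) ≡ (+ 2 * k + 0ℤ) * (+ 2 * k + 0ℤ)
  identity = solve-∀

nonZero₃-neg : ∀ {x} → NonZero₃ x → NonZero₃ (- x)
nonZero₃-neg {x} (inj₁ r) = inj₂ (subst One₃ (sym (ℤ.neg-involutive x)) r)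
nonZero₃-neg     (inj₂ r) = inj₁ r

nonZero₃-half : ∀ {x y} → x ≡ + 2 * y → NonZero₃ x → NonZero₃ y
nonZero₃-half {x} {y} x≡2y (inj₁ (k , x≡)) =
  inj₂ (y - + 2 * k - 1ℤ , from-difference (- + 2) (trans (sym x≡2y) x≡) (identity y k))
  where
  identity : ∀ y k → - y - (+ 3 * (y - + 2 * k - 1ℤ) + 1ℤ) ≡ - + 2 * (+ 2 * y - (+ 3 * k + 1ℤ))
  identity = solve-∀
nonZero₃-half {x} {y} x≡2y (inj₂ (k , -x≡)) =
  inj₁ (- y - + 2 * k - 1ℤ , from-difference (- + 2) (trans (cong -_ (sym x≡2y)) -x≡) (identity y k))
  where
  identity : ∀ y k → y - (+ 3 * (- y - + 2 * k - 1ℤ) + 1ℤ) ≡ - + 2 * (- (+ 2 * y) - (+ 3 * k + 1ℤ))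
  identity = solve-∀

even-double : ∀ {x} → Even x → ∃ λ f → x ≡ + 2 * f
even-double (f , refl) = f , ℤ.+-identityʳ (+ 2 * f)

double-square : ∀ {x f} → x ≡ + 2 * f → x * x ≡ + 4 * (f * f)
double-square {f = f} refl = identity f
  where
  identity : ∀ f → + 2 * f * (+ 2 * f) ≡ + 4 * (f * f)
  identity = solve-∀

-- Odd squares are 1 modulo 8 and 4f² is 0 or 4, so the value modulo 8 tells whether the even
-- coordinate 2f is divisible by 4: residue 3 forces `f` even, residue 7 forces `f` odd.
parity-mod-8 : ∀ i d r n {a b c f} → Odd a → Odd b → Odd c → Res 2 i f →
  + (8 ℕ.* d) * + n + + r ≡ a * a + b * b + c * c + + 4 * (f * f) →
  (3 ℕ.+ 4 ℕ.* bit i) ℕ.% 8 ≡ r ℕ.% 8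
parity-mod-8 i d r n {a} {b} {c} {f} ra rb rc rf eq
  with attains x a² ← attains-odd a ra | attains y b² ← attains-odd b rb | attains z c² ← attains-odd c rc
     | t , f² ← Res₂⇒SqRes₄ {i} rf =
  remainder-unique 8 (gonal 3 x + gonal 3 y + gonal 3 z + + 2 * t) (+ d * + n) (3 ℕ.+ 4 ℕ.* bit i) r (sym
    (trans (cong (_+ + r) (trans (sym (ℤ.*-assoc (+ 8) (+ d) (+ n))) (cong (_* + n) (sym (ℤ.pos-* 8 d)))))
    (trans eq (trans (cong₂ _+_ (cong₂ _+_ (cong₂ _+_ a² b²) c²) (cong (+ 4 *_) f²))
    (trans (collect (gonal 3 x) (gonal 3 y) (gonal 3 z) t (+ bit i))
      (cong (λ k → + 8 * (gonal 3 x + gonal 3 y + gonal 3 z + + 2 * t) + (+ 3 + k)) (sym (ℤ.pos-* 4 (bit i)))))))))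
  where
  collect : ∀ x y z t β → (+ 8 * x + 1ℤ) + (+ 8 * y + 1ℤ) + (+ 8 * z + 1ℤ) + + 4 * (+ 4 * t + β) ≡
                          + 8 * (x + y + z + + 2 * t) + (+ 3 + + 4 * β)
  collect = solve-∀

universal-p₅+p₅+p₅+4p₅ : Universal 1 5 1 5 1 5 4 5
universal-p₅+p₅+p₅+4p₅ = universal p₅ p₅ p₅ p₅ λ n → represent n (three-odd 6 7 n refl (four-ones 8 7 n 2≤ refl))
  where
  represent : ∀ n → Sum4 (One₃ ∩ Odd) (One₃ ∩ Odd) (One₃ ∩ Odd) (One₃ ∩ Even) (+ 24 * + n + + 7) →
              Represents 1 5 1 5 1 5 4 5 n
  represent n (sum4 {a} {b} {c} {d} ra rb rc (d₃ , d₂) eq)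
    with f , d≡2f ← even-double d₂
    with eq′ ← trans eq (cong (λ x → a * a + b * b + c * c + x) (double-square d≡2f))
    with parity f
  ... | false , f₂ with () ← parity-mod-8 false 3 7 n (proj₂ ra) (proj₂ rb) (proj₂ rc) f₂ eq′
  ... | true  , f₂ = attains⇒represents 24 1 1 1 4 1 1 1 4 n
    (attains-odd-one₃ a ra) (attains-odd-one₃ b rb) (attains-odd-one₃ c rc)
    (attains-scale 4 (attains-odd-nonZero₃ f (nonZero₃-half d≡2f (inj₁ d₃)) f₂)) eq′

universal-p₅+p₅+p₅+2p₈ : Universal 1 5 1 5 1 5 2 8
universal-p₅+p₅+p₅+2p₈ = universal p₅ p₅ p₅ p₈ λ n → represent n (three-odd 6 19 n refl (four-ones 8 19 n 2≤ refl))
  where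
  represent : ∀ n → Sum4 (One₃ ∩ Odd) (One₃ ∩ Odd) (One₃ ∩ Odd) (One₃ ∩ Even) (+ 24 * + n + + 19) →
              Represents 1 5 1 5 1 5 2 8 n
  represent n (sum4 {a} {b} {c} {d} ra rb rc (d₃ , d₂) eq)
    with f , d≡2f ← even-double d₂
    with eq′ ← trans eq (cong (λ x → a * a + b * b + c * c + x) (double-square d≡2f))
    with parity f
  ... | true  , f₂ with () ← parity-mod-8 true 3 19 n (proj₂ ra) (proj₂ rb) (proj₂ rc) f₂ eq′
  ... | false , f₂ = attains⇒represents 24 1 1 1 2 1 1 1 16 n
    (attains-odd-one₃ a ra) (attains-odd-one₃ b rb) (attains-odd-one₃ c rc)
    (attains-scale 4 (attains-even-nonZero₃ f (nonZero₃-half d≡2f (inj₁ d₃)) f₂)) eq′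

-- With e = 2p + 2q + 1 this reads m = b² + 2e² + 8(p - q)² + 4f².
data Balanced (m : ℤ) : Set where
  balanced : ∀ b p q f → One₃ b → Odd b → NonZero₃ f ⊎ NonZero₃ (+ 2 * p + + 2 * q + 1ℤ) →
    m ≡ b * b + (+ 4 * p + 1ℤ) * (+ 4 * p + 1ℤ) + (+ 4 * q + 1ℤ) * (+ 4 * q + 1ℤ) + + 4 * (f * f) → Balanced m

-- Once the signs make two odd numbers 1 modulo 4, their half-sum is odd and their half-difference
-- even, which gives the terms 2e² and 8(p - q)² of `Balanced`.
one-mod-4 : ∀ x → Odd x → ∃ λ p → (+ 4 * p + 1ℤ ≡ x) ⊎ (+ 4 * p + 1ℤ ≡ - x)
one-mod-4 x (k , refl) with parity k
... | false , j , refl = j , inj₁ (identity j)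
  where
  identity : ∀ j → + 4 * j + 1ℤ ≡ + 2 * (+ 2 * j + 0ℤ) + 1ℤ
  identity = solve-∀
... | true  , j , refl = - j - 1ℤ , inj₂ (identity j)
  where
  identity : ∀ j → + 4 * (- j - 1ℤ) + 1ℤ ≡ - (+ 2 * (+ 2 * j + 1ℤ) + 1ℤ)
  identity = solve-∀

±-square : ∀ {x y} → y ≡ x ⊎ y ≡ - x → y * y ≡ x * x
±-square         (inj₁ refl) = refl
±-square {x = x} (inj₂ refl) = neg² x

±-nonZero₃ : ∀ {x y} → y ≡ x ⊎ y ≡ - x → NonZero₃ x → NonZero₃ y
±-nonZero₃ (inj₁ refl) r = r
±-nonZero₃ (inj₂ refl) r = nonZero₃-neg r

±-zero₃ : ∀ {x y} → y ≡ x ⊎ y ≡ - x → Zero₃ x → Zero₃ y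
±-zero₃ (inj₁ refl) r = r
±-zero₃ (inj₂ refl) (k , refl) = - k , identity k
  where
  identity : ∀ k → - (+ 3 * k + 0ℤ) ≡ + 3 * - k + 0ℤ
  identity = solve-∀

nonZero₃-+-zero₃ : ∀ {x y} → NonZero₃ x → Zero₃ y → NonZero₃ (x + y)
nonZero₃-+-zero₃ (inj₁ r) z = inj₁ (one₃-+-zero₃ r z)
nonZero₃-+-zero₃ {x} {y} (inj₂ r) z =
  inj₂ (subst One₃ (sym (ℤ.neg-distrib-+ x y)) (one₃-+-zero₃ r (±-zero₃ {y} (inj₂ refl) z)))

nonZero₃-+-same : ∀ {x y} → One₃ x × One₃ y ⊎ One₃ (- x) × One₃ (- y) → NonZero₃ (x + y)
nonZero₃-+-same (inj₁ (rx , ry)) = inj₂ (one₃-+-one₃ rx ry)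
nonZero₃-+-same {x} {y} (inj₂ (rx , ry)) = inj₁ (subst One₃ (identity x y) (one₃-+-one₃ rx ry))
  where
  identity : ∀ x y → - (- x + - y) ≡ x + y
  identity = solve-∀

nonZero₃-mean : ∀ p q → NonZero₃ ((+ 4 * p + 1ℤ) + (+ 4 * q + 1ℤ)) → NonZero₃ (+ 2 * p + + 2 * q + 1ℤ)
nonZero₃-mean p q = nonZero₃-half (identity p q)
  where
  identity : ∀ p q → (+ 4 * p + 1ℤ) + (+ 4 * q + 1ℤ) ≡ + 2 * (+ 2 * p + + 2 * q + 1ℤ)
  identity = solve-∀

balance : ∀ {b c d e} p q f → One₃ b → Odd b →
  + 4 * p + 1ℤ ≡ c ⊎ + 4 * p + 1ℤ ≡ - c → + 4 * q + 1ℤ ≡ d ⊎ + 4 * q + 1ℤ ≡ - d → e ≡ + 2 * f →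
  NonZero₃ f ⊎ NonZero₃ (+ 2 * p + + 2 * q + 1ℤ) → m ≡ b * b + c * c + d * d + e * e → Balanced m
balance {b = b} p q f b₃ b₂ P Q e≡2f nz eq = balanced b p q f b₃ b₂ nz
  (trans eq (cong₂ _+_ (cong₂ _+_ (cong (λ s → b * b + s) (sym (±-square P))) (sym (±-square Q))) (double-square e≡2f)))

balance-even : Sum4 (One₃ ∩ Odd) (U ∩ Odd) (U ∩ Odd) (One₃ ∩ Even) m → Balanced m
balance-even (sum4 {b} {c} {d} {e} (b₃ , b₂) (_ , c₂) (_ , d₂) (e₃ , e₂) eq)
  with p , P ← one-mod-4 c c₂ | q , Q ← one-mod-4 d d₂ | f , e≡2f ← even-double e₂ =
  balance p q f b₃ b₂ P Q e≡2f (inj₁ (nonZero₃-half e≡2f (inj₁ e₃))) eq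

-- One of `c`, `d` is prime to 3 and the other is not, so their mean is prime to 3 whatever signs
-- `one-mod-4` picks.
balance-odd : Sum4 (One₃ ∩ Odd) (One₃ ∩ Odd) (Zero₃ ∩ Odd) (U ∩ Even) m → Balanced m
balance-odd (sum4 {b} {c} {d} {e} (b₃ , b₂) (c₃ , c₂) (d₃ , d₂) (_ , e₂) eq)
  with p , P ← one-mod-4 c c₂ | q , Q ← one-mod-4 d d₂ | f , e≡2f ← even-double e₂ =
  balance p q f b₃ b₂ P Q e≡2f
    (inj₂ (nonZero₃-mean p q (nonZero₃-+-zero₃ (±-nonZero₃ P (inj₁ c₃)) (±-zero₃ Q d₃)))) eq

-- Two of the three odd numbers, normalised to be 1 mod 4, agree mod 3.
balance-odds : Sum4 (One₃ ∩ Odd) (One₃ ∩ Odd) (One₃ ∩ Odd) (U ∩ Even) m → Balanced m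
balance-odds {m} (sum4 {b} {c} {d} {e} (b₃ , b₂) (c₃ , c₂) (d₃ , d₂) (_ , e₂) eq)
  with p , P ← one-mod-4 b b₂ | q , Q ← one-mod-4 c c₂ | r , R ← one-mod-4 d d₂ | f , e≡2f ← even-double e₂ =
  agree (±-nonZero₃ P (inj₁ b₃)) (±-nonZero₃ Q (inj₁ c₃)) (±-nonZero₃ R (inj₁ d₃))
  where
  Same : ℤ → ℤ → Set
  Same p q = One₃ (+ 4 * p + 1ℤ) × One₃ (+ 4 * q + 1ℤ) ⊎ One₃ (- (+ 4 * p + 1ℤ)) × One₃ (- (+ 4 * q + 1ℤ))
  mean : ∀ p q → Same p q → NonZero₃ (+ 2 * p + + 2 * q + 1ℤ)
  mean p q s = nonZero₃-mean p q (nonZero₃-+-same s)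
  move-d : ∀ b c d e → b * b + c * c + d * d + e * e ≡ d * d + b * b + c * c + e * e
  move-d = solve-∀
  move-c : ∀ b c d e → b * b + c * c + d * d + e * e ≡ c * c + b * b + d * d + e * e
  move-c = solve-∀
  first-two : Same p q → Balanced m
  first-two s = balance p q f d₃ d₂ P Q e≡2f (inj₂ (mean p q s)) (trans eq (move-d b c d e))
  outer-two : Same p r → Balanced m
  outer-two s = balance p r f c₃ c₂ P R e≡2f (inj₂ (mean p r s)) (trans eq (move-c b c d e))
  last-two : Same q r → Balanced m
  last-two s = balance q r f b₃ b₂ Q R e≡2f (inj₂ (mean q r s)) eq
  agree : NonZero₃ (+ 4 * p + 1ℤ) → NonZero₃ (+ 4 * q + 1ℤ) → NonZero₃ (+ 4 * r + 1ℤ) → Balanced m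
  agree (inj₁ x) (inj₁ y) _        = first-two (inj₁ (x , y))
  agree (inj₂ x) (inj₂ y) _        = first-two (inj₂ (x , y))
  agree (inj₁ x) (inj₂ _) (inj₁ z) = outer-two (inj₁ (x , z))
  agree (inj₂ x) (inj₁ _) (inj₂ z) = outer-two (inj₂ (x , z))
  agree (inj₁ _) (inj₂ y) (inj₂ z) = last-two (inj₂ (y , z))
  agree (inj₂ _) (inj₁ y) (inj₁ z) = last-two (inj₁ (y , z))

-- The last two classes vary among the cases of `TwoOnes`; storing them in the predicate merges
-- these cases before the split by parity.
AnyRes₃ : Pred ℤ 0ℓ
AnyRes₃ x = ∃ λ i → Res 3 i x

with-residue : ∀ {i} → Res 3 i ⊑ AnyRes₃
with-residue {i} x r = x , (i , r) , refl

-- Three coordinates are odd and at least two are prime to 3, so an odd one prime to 3 is available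
-- as `b`. If the even coordinate is prime to 3, so is its half f; otherwise the two remaining odd
-- ones must supply a mean prime to 3.
balanced-in-progression : ∀ d r n → 2 ℕ.≤ r → r ℕ.% 4 ≡ 3 → Balanced (+ (4 ℕ.* d) * + n + + r)
balanced-in-progression d r n 2≤r r≡3 = sorted (two-ones-any (twoOnes-in-progression (4 ℕ.* d) r n 2≤r))
  where
  N = + (4 ℕ.* d) * + n + + r
  two-ones-any : TwoOnes N → Sum4 One₃ One₃ AnyRes₃ AnyRes₃ N
  two-ones-any (four s)  = map4 ⊑-refl ⊑-refl with-residue with-residue s
  two-ones-any (three s) = map4 ⊑-refl ⊑-refl with-residue with-residue s
  two-ones-any (two s)   = map4 ⊑-refl ⊑-refl with-residue with-residue s
  any : ∀ {P Q} → (P ∩ Q) ⊑ (U ∩ Q)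
  any x (_ , q) = x , (tt , q) , refl
  even-last : Sum4 (One₃ ∩ Odd) (One₃ ∩ Odd) (AnyRes₃ ∩ Odd) (AnyRes₃ ∩ Even) N → Balanced N
  even-last (sum4 rb rc rd ((true , e₃) , e₂) eq) = balance-even (sum4 rb (tt , proj₂ rc) (tt , proj₂ rd) (e₃ , e₂) eq)
  even-last (sum4 rb rc ((false , d₃) , d₂) ((false , _) , e₂) eq) = balance-odd (sum4 rb rc (d₃ , d₂) (tt , e₂) eq)
  even-last (sum4 rb rc ((true , d₃) , d₂) ((false , _) , e₂) eq) = balance-odds (sum4 rb rc (d₃ , d₂) (tt , e₂) eq)
  sorted : Sum4 One₃ One₃ AnyRes₃ AnyRes₃ N → Balanced N
  sorted s with parities s
  ... | true  , true  , true  , false , s = even-last s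
  ... | true  , true  , false , true  , s = even-last (swap₃₄ s)
  ... | true  , false , true  , true  , s = balance-even (swap₃₄ (swap₂₃ (map4 ⊑-refl ⊑-refl any any s)))
  ... | false , true  , true  , true  , s = balance-even (swap₃₄ (swap₂₃ (swap₁₂ (map4 ⊑-refl ⊑-refl any any s))))
  ... | true  , false , false , false , s with () ← trans (parity-count d r n s) r≡3
  ... | false , true  , false , false , s with () ← trans (parity-count d r n s) r≡3
  ... | false , false , true  , false , s with () ← trans (parity-count d r n s) r≡3
  ... | false , false , false , true  , s with () ← trans (parity-count d r n s) r≡3
  ... | true  , true  , false , false , s with () ← trans (parity-count d r n s) r≡3
  ... | true  , false , true  , false , s with () ← trans (parity-count d r n s) r≡3
  ... | true  , false , false , true  , s with () ← trans (parity-count d r n s) r≡3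
  ... | false , true  , true  , false , s with () ← trans (parity-count d r n s) r≡3
  ... | false , true  , false , true  , s with () ← trans (parity-count d r n s) r≡3
  ... | false , false , true  , true  , s with () ← trans (parity-count d r n s) r≡3
  ... | true  , true  , true  , true  , s with () ← trans (parity-count d r n s) r≡3
  ... | false , false , false , false , s with () ← trans (parity-count d r n s) r≡3

odd-4p+1 : ∀ p → Odd (+ 4 * p + 1ℤ)
odd-4p+1 p = + 2 * p , identity p
  where
  identity : ∀ p → + 4 * p + 1ℤ ≡ + 2 * (+ 2 * p) + 1ℤ
  identity = solve-∀

balanced-parity : ∀ i d r n {b p q f} → Odd b → Res 2 i f →
  + (8 ℕ.* d) * + n + + r ≡ b * b + (+ 4 * p + 1ℤ) * (+ 4 * p + 1ℤ) + (+ 4 * q + 1ℤ) * (+ 4 * q + 1ℤ) + + 4 * (f * f) →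
  (3 ℕ.+ 4 ℕ.* bit i) ℕ.% 8 ≡ r ℕ.% 8
balanced-parity i d r n {p = p} {q} b₂ f₂ eq = parity-mod-8 i d r n b₂ (odd-4p+1 p) (odd-4p+1 q) f₂ eq

move-first-last : ∀ a b c d → a * a + b * b + c * c + + 4 * (d * d) ≡ b * b + c * c + + 4 * (d * d) + a * a
move-first-last = solve-∀

universal-p₃+p₃+2p₄+3p₅ : Universal 1 3 1 3 2 4 3 5
universal-p₃+p₃+2p₄+3p₅ = universal p₃ p₃ p₄ p₅ λ n → represent n (balanced-in-progression 2 3 n 2≤ refl)
  where
  represent : ∀ n → Balanced (+ 8 * + n + + 3) → Represents 1 3 1 3 2 4 3 5 n
  represent n (balanced b p q f b₃ b₂ _ eq) with parity f
  ... | true  , f₂ with () ← balanced-parity true 1 3 n {b} {p} {q} b₂ f₂ eq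
  ... | false , f₂ = attains⇒represents 8 1 1 2 3 1 1 0 1 n
    (attains-odd (+ 4 * p + 1ℤ) (odd-4p+1 p)) (attains-odd (+ 4 * q + 1ℤ) (odd-4p+1 q))
    (attains-scale 4 (attains-even f f₂)) (attains-odd-one₃ b (b₃ , b₂))
    (trans eq (move-first-last b (+ 4 * p + 1ℤ) (+ 4 * q + 1ℤ) f))

universal-p₃+p₃+4p₃+3p₅ : Universal 1 3 1 3 4 3 3 5
universal-p₃+p₃+4p₃+3p₅ = universal p₃ p₃ p₃ p₅ λ n → represent n (balanced-in-progression 2 7 n 2≤ refl)
  where
  represent : ∀ n → Balanced (+ 8 * + n + + 7) → Represents 1 3 1 3 4 3 3 5 n
  represent n (balanced b p q f b₃ b₂ _ eq) with parity f
  ... | false , f₂ with () ← balanced-parity false 1 7 n {b} {p} {q} b₂ f₂ eq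
  ... | true  , f₂ = attains⇒represents 8 1 1 4 3 1 1 4 1 n
    (attains-odd (+ 4 * p + 1ℤ) (odd-4p+1 p)) (attains-odd (+ 4 * q + 1ℤ) (odd-4p+1 q))
    (attains-scale 4 (attains-odd f f₂)) (attains-odd-one₃ b (b₃ , b₂))
    (trans eq (move-first-last b (+ 4 * p + 1ℤ) (+ 4 * q + 1ℤ) f))

-- (e + 2g)² + 2(e - g)² = 3(e² + 2f²), and some sign of g makes both squares on the left prime to 3.
Separated : ℤ → ℤ → Set
Separated e f = ∃ λ g → (g ≡ f ⊎ g ≡ - f) × NonZero₃ (e + + 2 * g) × NonZero₃ (e - g)

separated-neg : ∀ e f → Separated e (- f) → Separated e f
separated-neg e f (g , inj₁ g≡-f  , rs) = g , inj₂ g≡-f , rs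
separated-neg e f (g , inj₂ g≡--f , rs) = g , inj₁ (trans g≡--f (ℤ.neg-involutive f)) , rs

neg-separated : ∀ e f → Separated (- e) f → Separated e f
neg-separated e f (g , g≡±f , r , s) = - g , negate g≡±f ,
  subst NonZero₃ (identity₁ e g) (nonZero₃-neg r) , subst NonZero₃ (identity₂ e g) (nonZero₃-neg s)
  where
  identity₁ : ∀ e g → - (- e + + 2 * g) ≡ e + + 2 * - g
  identity₁ = solve-∀
  identity₂ : ∀ e g → - (- e - g) ≡ e - - g
  identity₂ = solve-∀
  negate : g ≡ f ⊎ g ≡ - f → - g ≡ f ⊎ - g ≡ - f
  negate (inj₁ refl) = inj₂ refl
  negate (inj₂ refl) = inj₁ (ℤ.neg-involutive f)

separate-zero-one : ∀ {e f} → Zero₃ e → One₃ f → Separated e f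
separate-zero-one {_} {f} (k , refl) (l , refl) =
  f , inj₁ refl , inj₂ (- k - + 2 * l - 1ℤ , identity₁ k l) , inj₂ (l - k , identity₂ k l)
  where
  identity₁ : ∀ k l → - (+ 3 * k + 0ℤ + + 2 * (+ 3 * l + 1ℤ)) ≡ + 3 * (- k - + 2 * l - 1ℤ) + 1ℤ
  identity₁ = solve-∀
  identity₂ : ∀ k l → - (+ 3 * k + 0ℤ - (+ 3 * l + 1ℤ)) ≡ + 3 * (l - k) + 1ℤ
  identity₂ = solve-∀

separate-one-zero : ∀ {e f} → One₃ e → Zero₃ f → Separated e f
separate-one-zero {_} {f} (k , refl) (l , refl) =
  f , inj₁ refl , inj₁ (k + + 2 * l , identity₁ k l) , inj₁ (k - l , identity₂ k l)
  where
  identity₁ : ∀ k l → + 3 * k + 1ℤ + + 2 * (+ 3 * l + 0ℤ) ≡ + 3 * (k + + 2 * l) + 1ℤ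
  identity₁ = solve-∀
  identity₂ : ∀ k l → + 3 * k + 1ℤ - (+ 3 * l + 0ℤ) ≡ + 3 * (k - l) + 1ℤ
  identity₂ = solve-∀

separate-one-one : ∀ {e f} → One₃ e → One₃ f → Separated e f
separate-one-one {_} {f} (k , refl) (l , refl) =
  - f , inj₂ refl , inj₂ (+ 2 * l - k , identity₁ k l) , inj₂ (- k - l - 1ℤ , identity₂ k l)
  where
  identity₁ : ∀ k l → - (+ 3 * k + 1ℤ + + 2 * - (+ 3 * l + 1ℤ)) ≡ + 3 * (+ 2 * l - k) + 1ℤ
  identity₁ = solve-∀
  identity₂ : ∀ k l → - (+ 3 * k + 1ℤ - - (+ 3 * l + 1ℤ)) ≡ + 3 * (- k - l - 1ℤ) + 1ℤ
  identity₂ = solve-∀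

separate-nonZero : ∀ e f → NonZero₃ e → Separated e f
separate-nonZero e f (inj₂ r) = neg-separated e f (separate-nonZero (- e) f (inj₁ r))
separate-nonZero e f (inj₁ r) with zero-or-nonZero₃ f
... | inj₁ z        = separate-one-zero r z
... | inj₂ (inj₁ s) = separate-one-one r s
... | inj₂ (inj₂ s) = separated-neg e f (separate-one-one r s)

-- Since e + 2g ≡ e - g modulo 3, the only requirement is g ≢ e, and one of g = f, g = -f meets it
-- unless both `e` and `f` are divisible by 3.
separate : ∀ e f → NonZero₃ f ⊎ NonZero₃ e → Separated e f
separate e f (inj₂ r) = separate-nonZero e f r
separate e f (inj₁ r) with zero-or-nonZero₃ e
... | inj₂ s = separate-nonZero e f s
separate e f (inj₁ (inj₁ r)) | inj₁ z = separate-zero-one z r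
separate e f (inj₁ (inj₂ r)) | inj₁ z = separated-neg e f (separate-zero-one z r)

±-parity : ∀ i {x y} → y ≡ x ⊎ y ≡ - x → Res 2 i x → Res 2 i y
±-parity i (inj₁ refl) r = r
±-parity i (inj₂ refl) r = neg-parity i r

odd-mean : ∀ p q → Odd (+ 2 * p + + 2 * q + 1ℤ)
odd-mean p q = p + q , identity p q
  where
  identity : ∀ p q → + 2 * p + + 2 * q + 1ℤ ≡ + 2 * (p + q) + 1ℤ
  identity = solve-∀

even-2* : ∀ g → Even (+ 2 * g)
even-2* g = g , sym (ℤ.+-identityʳ (+ 2 * g))

-- Tripling b² + 2(e² + 2f²) + 8(p - q)² and trading 3(e² + 2g²) yields the weights 24, 2, 3, 4 for
-- p₄, 2p₅, 3p₅ and a last term whose base is e - g.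
thrice : ∀ n r b p q f g → f * f ≡ g * g →
  + 8 * n + r ≡ b * b + (+ 4 * p + 1ℤ) * (+ 4 * p + 1ℤ) + (+ 4 * q + 1ℤ) * (+ 4 * q + 1ℤ) + + 4 * (f * f) →
  + 24 * n + + 3 * r ≡ + 24 * ((p - q) * (p - q)) +
    + 2 * ((+ 2 * p + + 2 * q + 1ℤ + + 2 * g) * (+ 2 * p + + 2 * q + 1ℤ + + 2 * g)) + + 3 * (b * b) +
    + 4 * ((+ 2 * p + + 2 * q + 1ℤ - g) * (+ 2 * p + + 2 * q + 1ℤ - g))
thrice n r b p q f g f²≡g² eq = from-difference (+ 3)
  (trans eq (cong (λ s → b * b + (+ 4 * p + 1ℤ) * (+ 4 * p + 1ℤ) + (+ 4 * q + 1ℤ) * (+ 4 * q + 1ℤ) + + 4 * s) f²≡g²))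
  (identity n r b p q g)
  where
  identity : ∀ n r b p q g → + 24 * n + + 3 * r - (+ 24 * ((p - q) * (p - q)) +
    + 2 * ((+ 2 * p + + 2 * q + 1ℤ + + 2 * g) * (+ 2 * p + + 2 * q + 1ℤ + + 2 * g)) + + 3 * (b * b) +
    + 4 * ((+ 2 * p + + 2 * q + 1ℤ - g) * (+ 2 * p + + 2 * q + 1ℤ - g))) ≡
    + 3 * (+ 8 * n + r - (b * b + (+ 4 * p + 1ℤ) * (+ 4 * p + 1ℤ) + (+ 4 * q + 1ℤ) * (+ 4 * q + 1ℤ) + + 4 * (g * g)))
  identity = solve-∀

universal-p₄+2p₅+3p₅+4p₅ : Universal 1 4 2 5 3 5 4 5
universal-p₄+2p₅+3p₅+4p₅ = universal p₄ p₅ p₅ p₅ λ n → represent n (balanced-in-progression 2 3 n 2≤ refl)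
  where
  represent : ∀ n → Balanced (+ 8 * + n + + 3) → Represents 1 4 2 5 3 5 4 5 n
  represent n (balanced b p q f b₃ b₂ nz eq)
    with g , g≡±f , r , s ← separate (+ 2 * p + + 2 * q + 1ℤ) f nz | parity f
  ... | true  , f₂ with () ← balanced-parity true 1 3 n {b} {p} {q} b₂ f₂ eq
  ... | false , f₂ = attains⇒represents 24 1 2 3 4 0 2 3 4 n
    (attains-scale 24 (attains-square (p - q)))
    (attains-scale 2 (attains-odd-nonZero₃ (e + + 2 * g) r (odd-+-even true (odd-mean p q) (even-2* g))))
    (attains-scale 3 (attains-odd-one₃ b (b₃ , b₂)))
    -- The value 8n + 3 makes `f` even, hence e - g odd, which suits 4p₅; with 8n + 7 it is even,
    -- which suits 2p₈.
    (attains-scale 4 (attains-odd-nonZero₃ (e - g) s (odd-−-even true (odd-mean p q) (±-parity false g≡±f f₂))))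
    (thrice (+ n) (+ 3) b p q f g (sym (±-square g≡±f)) eq)
    where
    e = + 2 * p + + 2 * q + 1ℤ

universal-p₄+2p₅+3p₅+2p₈ : Universal 1 4 2 5 3 5 2 8
universal-p₄+2p₅+3p₅+2p₈ = universal p₄ p₅ p₅ p₈ λ n → represent n (balanced-in-progression 2 7 n 2≤ refl)
  where
  represent : ∀ n → Balanced (+ 8 * + n + + 7) → Represents 1 4 2 5 3 5 2 8 n
  represent n (balanced b p q f b₃ b₂ nz eq)
    with g , g≡±f , r , s ← separate (+ 2 * p + + 2 * q + 1ℤ) f nz | parity f
  ... | false , f₂ with () ← balanced-parity false 1 7 n {b} {p} {q} b₂ f₂ eq
  ... | true  , f₂ = attains⇒represents 24 1 2 3 2 0 2 3 16 n
    (attains-scale 24 (attains-square (p - q)))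
    (attains-scale 2 (attains-odd-nonZero₃ (e + + 2 * g) r (odd-+-even true (odd-mean p q) (even-2* g))))
    (attains-scale 3 (attains-odd-one₃ b (b₃ , b₂)))
    (attains-scale 4 (attains-even-nonZero₃ (e - g) s (same-parity-− true (odd-mean p q) (±-parity true g≡±f f₂))))
    (thrice (+ n) (+ 7) b p q f g (sym (±-square g≡±f)) eq)
    where
    e = + 2 * p + + 2 * q + 1ℤ

theorem3p3 : Universal 2 5 2 5 1 8 1 8
    × Universal 1 8 1 8 1 8 1 8
    × Universal 3 4 3 4 1 8 1 8
    × Universal 6 3 3 4 2 5 1 8
    × Universal 3 3 1 5 2 5 2 5
    × Universal 3 3 1 5 1 8 1 8
    × Universal 3 4 1 5 1 5 1 8
    × Universal 6 3 1 5 1 5 2 5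
    × Universal 1 5 1 5 1 5 4 5
    × Universal 1 5 1 5 1 5 2 8
    × Universal 1 3 1 3 2 4 3 5
    × Universal 1 3 1 3 4 3 3 5
    × Universal 1 4 2 5 3 5 4 5
    × Universal 1 4 2 5 3 5 2 8
    × Universal 2 5 2 5 2 5 1 8
    × Universal 2 5 1 8 1 8 1 8
theorem3p3 =
    universal-2p₅+2p₅+p₈+p₈
  , universal-p₈+p₈+p₈+p₈
  , universal-3p₄+3p₄+p₈+p₈
  , universal-6p₃+3p₄+2p₅+p₈
  , universal-3p₃+p₅+2p₅+2p₅
  , universal-3p₃+p₅+p₈+p₈
  , universal-3p₄+p₅+p₅+p₈
  , universal-6p₃+p₅+p₅+2p₅
  , universal-p₅+p₅+p₅+4p₅
  , universal-p₅+p₅+p₅+2p₈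
  , universal-p₃+p₃+2p₄+3p₅
  , universal-p₃+p₃+4p₃+3p₅
  , universal-p₄+2p₅+3p₅+4p₅
  , universal-p₄+2p₅+3p₅+2p₈
  , universal-2p₅+2p₅+2p₅+p₈
  , universal-2p₅+p₈+p₈+p₈
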